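{- For all positive integers $d\le n$, \begin{equation*} \sum_{j=0}^{\lfloor \frac{d-1}2\rfloor} \frac{ (2^{2n-2j}-1)B_{2n-2j} }{2^{2d-1} d} \binom{2d-2j-2}{d-1} \binom{2n}{2j} =\frac{(-1)^{d+1}}{4^n}\sum_{\ell =0}^{n-d} \binom{n-\ell}{d}\binom{2n}{2\ell}E_{2\ell}. \end{equation*} Further, for positive integers $n<d$ (where binomial coefficients $\binom{2n}{2j}$ with $j>n$ are $0$), \begin{equation*} \sum_{j=0}^{\lfloor \frac{d-1}2\rfloor} \frac{ (2^{2n-2j}-1)B_{2n-2j} }{2^{2d-1} d} \binom{2d-2j-2}{d-1} \binom{2n}{2j} = \begin{cases} 0, & \text{if } n<d<2n,\\[2pt] \displaystyle \frac{n}{2^{2d-1} d} \binom{2d-2n-1}{d-1} , & \text{if } d\ge 2n. \end{cases} \end{equation*}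
   Context: The Bernoulli numbers $B_j$ are defined by $\frac{x}{e^x-1}=\sum_{j\ge0}B_j\frac{x^j}{j!}$. The Euler numbers $E_{2j}$ are defined by $\sec x=\sum_{j\ge0}(-1)^jE_{2j}\frac{x^{2j}}{(2j)!}$. -}

module Defs where

open import Data.Nat as ℕ using (ℕ; zero; suc)
open import Data.Nat.Combinatorics using (_C_)
open import Data.Integer using (+_)
open import Data.List using (List; []; _∷_; _++_; length; reverse)
open import Data.Rational using (ℚ; _/_; _+_; _*_; -_; 0ℚ; 1ℚ)

fromℕ : ℕ → ℚ
fromℕ k = (+ k) / 1

-- 1/k for k ≥ 1 (only ever applied to nonzero arguments; inv 0 = 0 by convention)
inv : ℕ → ℚ
inv zero    = 0ℚ
inv (suc k) = (+ 1) / suc k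

sign : ℕ → ℚ
sign zero          = 1ℚ
sign (suc zero)    = - 1ℚ
sign (suc (suc k)) = sign k

sumTo : ℕ → (ℕ → ℚ) → ℚ
sumTo zero    f = f 0
sumTo (suc m) f = sumTo m f + f (suc m)

sumIdx : (ℕ → ℚ → ℚ) → List ℚ → ℚ
sumIdx g l = go 0 l
  where
  go : ℕ → List ℚ → ℚ
  go i []       = 0ℚ
  go i (x ∷ xs) = g i x + go (suc i) xs

-- Bernoulli numbers, from x = (e^x - 1) · Σ B_j x^j / j!, i.e. comparing
-- coefficients of x^{m+1}/(m+1)!:  Σ_{k=0}^{m} C(m+1,k) B_k = [m = 0].
-- bernNext [B_0,…,B_{m-1}] = B_m.
bernNext : List ℚ → ℚ
bernNext []        = 1ℚ
bernNext l@(_ ∷ _) =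
  - (inv (suc m) * sumIdx (λ k b → fromℕ (suc m C k) * b) l)
  where m = length l

bernList : ℕ → List ℚ
bernList zero    = []
bernList (suc m) = bernList m ++ (bernNext (bernList m) ∷ [])

B : ℕ → ℚ
B m = bernNext (bernList m)

-- Euler numbers E_{2j}, from cos x · sec x = 1 with
-- sec x = Σ (-1)^j E_{2j} x^{2j}/(2j)!: coefficient of x^{2n}/(2n)! gives
-- Σ_{k=0}^{n} C(2n,2k) E_{2k} = [n = 0].
-- eulerNext [E_0,E_2,…,E_{2n-2}] = E_{2n}.
eulerNext : List ℚ → ℚ
eulerNext []        = 1ℚ
eulerNext l@(_ ∷ _) = - sumIdx (λ k e → fromℕ ((2 ℕ.* n) C (2 ℕ.* k)) * e) l
  where n = length l

eulerList : ℕ → List ℚ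
eulerList zero    = []
eulerList (suc n) = eulerList n ++ (eulerNext (eulerList n) ∷ [])

E2 : ℕ → ℚ
E2 j = eulerNext (eulerList j)

lhs : ℕ → ℕ → ℚ
lhs d n = sumTo ℕ.⌊ d ℕ.∸ 1 /2⌋ (λ j →
  fromℕ (2 ℕ.^ (2 ℕ.* n ℕ.∸ 2 ℕ.* j) ℕ.∸ 1) * B (2 ℕ.* n ℕ.∸ 2 ℕ.* j)
  * inv (2 ℕ.^ (2 ℕ.* d ℕ.∸ 1) ℕ.* d)
  * fromℕ ((2 ℕ.* d ℕ.∸ 2 ℕ.* j ℕ.∸ 2) C (d ℕ.∸ 1))
  * fromℕ ((2 ℕ.* n) C (2 ℕ.* j)))

rhs : ℕ → ℕ → ℚ
rhs d n = sign (d ℕ.+ 1) * inv (4 ℕ.^ n)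
  * sumTo (n ℕ.∸ d) (λ ℓ → fromℕ ((n ℕ.∸ ℓ) C d) * fromℕ ((2 ℕ.* n) C (2 ℕ.* ℓ)) * E2 ℓ)

{-# OPTIONS --safe #-}
-- For k ≤ 2d - 2 the number C(2d-2-k, d-1) is the residue of z^k / (z(1-z))^d at
-- z = 0, so the left-hand side is, up to the factor 1 / (2^(2d-1) d), the residue of
-- P(z) / (z(1-z))^d, where P(z) = Σ_j C(2n,2j) (2^(2n-2j) - 1) B_{2n-2j} z^{2j}.
-- Since Σ_m (2^m - 1) B_m x^m/m! = -x / (e^x + 1), the polynomial P is
-- n z^{2n-1} - n E_{2n-1}(z) with E_{2n-1} the Euler polynomial. The first summand
-- yields the value for d ≥ 2n; the second one, expanded in powers of 1 - 2z with
-- coefficients given by Euler numbers, yields the right-hand side, because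
-- (1 - 2z)^2 = 1 - 4z(1-z) reduces the residue of (1-2z)^{2m+1} / (z(1-z))^d to
-- Pascal's rule. Series are handled as sequences of coefficients of x^n/n!, and the
-- residues are applied coefficientwise to e^{zx}.
module Submission where

open import Defs
open import Algebra using (CommutativeRing; IsCommutativeRing)
import Algebra.Construct.Pointwise as Pointwise
import Algebra.Solver.Ring as RingSolver
open import Algebra.Solver.Ring.AlmostCommutativeRing using (_-Raw-AlmostCommutative⟶_; fromCommutativeRing)
open import Data.Integer as ℤ using () renaming (+_ to pos)
import Data.Integer.Properties as ℤ
open import Data.List using (List; []; _∷_; _++_; length)
open import Data.List.Properties using (length-++)
open import Data.Maybe as Maybe using (Maybe)
open import Data.Nat as ℕ using (ℕ; zero; suc; _≤_; _<_; z≤n; s≤s; NonZero)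
open import Data.Nat.Combinatorics
  using (_C_; k>n⇒nCk≡0; nCn≡1; nC1≡n; nCk≡nC[n∸k]; nCk+nC[k+1]≡[n+1]C[k+1])
import Data.Nat.Properties as ℕ
import Data.Nat.Solver as ℕSolver
open import Data.Product using (∃; _×_; _,_)
open import Data.Rational using (ℚ; 0ℚ; 1ℚ; ½; _+_; _*_; -_; toℚᵘ)
import Data.Rational.Properties as ℚ
open import Data.Rational.Solver using (module +-*-Solver)
open import Data.Rational.Unnormalised as ℚᵘ using (mkℚᵘ; *≡*)
import Data.Rational.Unnormalised.Properties as ℚᵘ
open import Data.Sum using (_⊎_; inj₁; inj₂)
open import Function using (_∘_)
open import Level using (0ℓ)
open import Relation.Binary.PropositionalEquality
import Relation.Binary.Reasoning.Setoid as SetoidReasoning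
open import Relation.Nullary using (yes; no)
open import Relation.Nullary.Decidable using (dec⇒maybe)
open ≡-Reasoning
open +-*-Solver using (solve; _:+_; _:*_; :-_; _:=_; con)

-- The left-hand side contains only even powers of z, whereas -x / (e^x + 1) has the odd coefficient
-- -1/2 at x. Adding x/2 gives the even series (x/2) tanh (x/2), so that the full binomial
-- convolution with `Φ d` collapses to the sum in `lhs`; the price for x/2 is the summand n
-- z^(2n-1). The substitution x ↦ 2x gives -2x / (e^(2x) + 1) = -x e^(-x) sech x, and e^(-x) joins
-- e^(2zx) to form e^((2z-1)x); this rescaling is the source of 4^n. As sech is even and the index
-- 2n - 1 is odd, only odd powers of 2z - 1 occur. Their residues are accessible because w = z (1 -
-- z) has dw = (1 - 2z) dz: the residue of (2z-1)^(2m+1) / w^d is minus the coefficient of w^(d-1)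
-- in (1 - 4w)^m. The remaining powers of two cancel, since 2 · 4^(d-1) d = 2^(2d-1) d. In the final
-- lemmas `e` and `p` stand for d - 1 and n - 1.

-- Embedding the natural numbers into the rationals

fromℕ-+ : ∀ m n → fromℕ (m ℕ.+ n) ≡ fromℕ m + fromℕ n
fromℕ-+ m n = ℚ.toℚᵘ-injective (R.begin
  toℚᵘ (fromℕ (m ℕ.+ n))              R.≈⟨ ℚ.toℚᵘ-fromℚᵘ _ ⟩
  mkℚᵘ (pos (m ℕ.+ n)) 0              R.≈⟨ *≡* (cong (ℤ._* pos 1) (cong₂ ℤ._+_ (sym (ℤ.*-identityʳ (pos m))) (sym (ℤ.*-identityʳ (pos n))))) ⟩
  mkℚᵘ (pos m) 0 ℚᵘ.+ mkℚᵘ (pos n) 0  R.≈⟨ ℚᵘ.+-cong (ℚ.toℚᵘ-fromℚᵘ (mkℚᵘ (pos m) 0)) (ℚ.toℚᵘ-fromℚᵘ (mkℚᵘ (pos n) 0)) ⟨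
  toℚᵘ (fromℕ m) ℚᵘ.+ toℚᵘ (fromℕ n)  R.≈⟨ ℚ.toℚᵘ-homo-+ (fromℕ m) (fromℕ n) ⟨
  toℚᵘ (fromℕ m + fromℕ n)            R.∎)
  where module R = ℚᵘ.≃-Reasoning

fromℕ-* : ∀ m n → fromℕ (m ℕ.* n) ≡ fromℕ m * fromℕ n
fromℕ-* m n = ℚ.toℚᵘ-injective (R.begin
  toℚᵘ (fromℕ (m ℕ.* n))              R.≈⟨ ℚ.toℚᵘ-fromℚᵘ _ ⟩
  mkℚᵘ (pos (m ℕ.* n)) 0              R.≈⟨ *≡* (cong (ℤ._* pos 1) (ℤ.pos-* m n)) ⟩
  mkℚᵘ (pos m) 0 ℚᵘ.* mkℚᵘ (pos n) 0  R.≈⟨ ℚᵘ.*-cong (ℚ.toℚᵘ-fromℚᵘ (mkℚᵘ (pos m) 0)) (ℚ.toℚᵘ-fromℚᵘ (mkℚᵘ (pos n) 0)) ⟨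
  toℚᵘ (fromℕ m) ℚᵘ.* toℚᵘ (fromℕ n)  R.≈⟨ ℚ.toℚᵘ-homo-* (fromℕ m) (fromℕ n) ⟨
  toℚᵘ (fromℕ m * fromℕ n)            R.∎)
  where module R = ℚᵘ.≃-Reasoning

inv-* : ∀ n .{{_ : NonZero n}} → inv n * fromℕ n ≡ 1ℚ
inv-* (suc k) = ℚ.toℚᵘ-injective (R.begin
  toℚᵘ (inv (suc k) * fromℕ (suc k))            R.≈⟨ ℚ.toℚᵘ-homo-* (inv (suc k)) (fromℕ (suc k)) ⟩
  toℚᵘ (inv (suc k)) ℚᵘ.* toℚᵘ (fromℕ (suc k))  R.≈⟨ ℚᵘ.*-cong (ℚ.toℚᵘ-fromℚᵘ (mkℚᵘ (pos 1) k)) (ℚ.toℚᵘ-fromℚᵘ (mkℚᵘ (pos (suc k)) 0)) ⟩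
  mkℚᵘ (pos 1) k ℚᵘ.* mkℚᵘ (pos (suc k)) 0      R.≈⟨ *≡* (trans (ℤ.*-identityʳ _) (cong (λ m → pos 1 ℤ.* pos m) (sym (ℕ.*-identityʳ (suc k))))) ⟩
  ℚᵘ.1ℚᵘ                                        R.∎)
  where module R = ℚᵘ.≃-Reasoning

fromℕ-suc : ∀ n → fromℕ (suc n) ≡ 1ℚ + fromℕ n
fromℕ-suc = fromℕ-+ 1

*-cancelˡ-fromℕ : ∀ n .{{_ : NonZero n}} {p q} → fromℕ n * p ≡ fromℕ n * q → p ≡ q
*-cancelˡ-fromℕ n {p} {q} eq = begin
  p                      ≡⟨ ℚ.*-identityˡ p ⟨
  1ℚ * p                 ≡⟨ cong (_* p) (inv-* n) ⟨
  inv n * fromℕ n * p    ≡⟨ ℚ.*-assoc (inv n) (fromℕ n) p ⟩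
  inv n * (fromℕ n * p)  ≡⟨ cong (inv n *_) eq ⟩
  inv n * (fromℕ n * q)  ≡⟨ ℚ.*-assoc (inv n) (fromℕ n) q ⟨
  inv n * fromℕ n * q    ≡⟨ cong (_* q) (inv-* n) ⟩
  1ℚ * q                 ≡⟨ ℚ.*-identityˡ q ⟩
  q                      ∎

+-interchange : ∀ a b c d → (a + b) + (c + d) ≡ (a + c) + (b + d)
+-interchange = solve 4 (λ a b c d → (a :+ b) :+ (c :+ d) := (a :+ c) :+ (b :+ d)) refl

*-zero-middle : ∀ a {b} c → b ≡ 0ℚ → a * (b * c) ≡ 0ℚ
*-zero-middle a c refl = trans (cong (a *_) (ℚ.*-zeroˡ c)) (ℚ.*-zeroʳ a)

-- Finite sums

sumTo-cong : ∀ n {f g} → (∀ k → k ≤ n → f k ≡ g k) → sumTo n f ≡ sumTo n g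
sumTo-cong zero    f≗g = f≗g 0 z≤n
sumTo-cong (suc n) f≗g =
  cong₂ _+_ (sumTo-cong n λ k k≤n → f≗g k (ℕ.m≤n⇒m≤1+n k≤n)) (f≗g (suc n) ℕ.≤-refl)

sumTo-+ : ∀ n f g → sumTo n (λ k → f k + g k) ≡ sumTo n f + sumTo n g
sumTo-+ zero    f g = refl
sumTo-+ (suc n) f g =
  trans (cong (_+ (f (suc n) + g (suc n))) (sumTo-+ n f g))
        (+-interchange (sumTo n f) (sumTo n g) (f (suc n)) (g (suc n)))

sumTo-*ˡ : ∀ n c f → sumTo n (λ k → c * f k) ≡ c * sumTo n f
sumTo-*ˡ zero    c f = refl
sumTo-*ˡ (suc n) c f =
  trans (cong (_+ c * f (suc n)) (sumTo-*ˡ n c f))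
        (sym (ℚ.*-distribˡ-+ c (sumTo n f) (f (suc n))))

sumTo-suc : ∀ n f → sumTo (suc n) f ≡ f 0 + sumTo n (f ∘ suc)
sumTo-suc zero    f = refl
sumTo-suc (suc n) f =
  trans (cong (_+ f (suc (suc n))) (sumTo-suc n f)) (ℚ.+-assoc (f 0) _ _)

sumTo-extend : ∀ {m n} f → m ≤ n → (∀ k → m < k → f k ≡ 0ℚ) → sumTo n f ≡ sumTo m f
sumTo-extend {n = zero}  f z≤n vanish = refl
sumTo-extend {m} {suc n} f m≤1+n vanish with ℕ.m≤n⇒m<n∨m≡n m≤1+n
... | inj₂ refl      = refl
... | inj₁ (s≤s m≤n) = begin
  sumTo n f + f (suc n)  ≡⟨ cong₂ _+_ (sumTo-extend f m≤n vanish) (vanish (suc n) (s≤s m≤n)) ⟩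
  sumTo m f + 0ℚ         ≡⟨ ℚ.+-identityʳ (sumTo m f) ⟩
  sumTo m f              ∎

sumTo-0 : ∀ n {f} → (∀ k → k ≤ n → f k ≡ 0ℚ) → sumTo n f ≡ 0ℚ
sumTo-0 zero    f≗0 = f≗0 0 z≤n
sumTo-0 (suc n) f≗0 =
  cong₂ _+_ (sumTo-0 n λ k k≤n → f≗0 k (ℕ.m≤n⇒m≤1+n k≤n)) (f≗0 (suc n) ℕ.≤-refl)

sumTo-evens : ∀ n f → (∀ k → k < n → f (suc (2 ℕ.* k)) ≡ 0ℚ) →
              sumTo (2 ℕ.* n) f ≡ sumTo n (λ k → f (2 ℕ.* k))
sumTo-evens zero    f vanish = refl
sumTo-evens (suc n) f vanish = begin
  sumTo (2 ℕ.* suc n) f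
    ≡⟨ cong (λ m → sumTo m f) (ℕ.*-suc 2 n) ⟩
  sumTo (2 ℕ.* n) f + f (suc (2 ℕ.* n)) + f (2 ℕ.+ 2 ℕ.* n)
    ≡⟨ cong (_+ f (2 ℕ.+ 2 ℕ.* n)) (cong₂ _+_ (sumTo-evens n f λ k k<n → vanish k (ℕ.m<n⇒m<1+n k<n)) (vanish n ℕ.≤-refl)) ⟩
  sumTo n (λ k → f (2 ℕ.* k)) + 0ℚ + f (2 ℕ.+ 2 ℕ.* n)
    ≡⟨ cong₂ _+_ (ℚ.+-identityʳ (sumTo n λ k → f (2 ℕ.* k))) (cong f (sym (ℕ.*-suc 2 n))) ⟩
  sumTo (suc n) (λ k → f (2 ℕ.* k)) ∎

sumTo-evens′ : ∀ n f → (∀ k → k ≤ n → f (suc (2 ℕ.* k)) ≡ 0ℚ) →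
               sumTo (suc (2 ℕ.* n)) f ≡ sumTo n (λ k → f (2 ℕ.* k))
sumTo-evens′ n f vanish = begin
  sumTo (2 ℕ.* n) f + f (suc (2 ℕ.* n))
    ≡⟨ cong₂ _+_ (sumTo-evens n f λ k k<n → vanish k (ℕ.<⇒≤ k<n)) (vanish n ℕ.≤-refl) ⟩
  sumTo n (λ k → f (2 ℕ.* k)) + 0ℚ
    ≡⟨ ℚ.+-identityʳ _ ⟩
  sumTo n (λ k → f (2 ℕ.* k)) ∎

-- The recursion of sumIdx

-- The helper local to sumIdx cannot be named; this metavariable is solved
-- to it by unification with the unfolded type of sumIdx-∷.
mutual
  sumIdxFrom : (ℕ → ℚ → ℚ) → List ℚ → ℕ → List ℚ → ℚ
  sumIdxFrom = _

  sumIdx-∷ : ∀ g x xs → sumIdx g (x ∷ xs) ≡ g 0 x + sumIdxFrom g (x ∷ xs) 1 xs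
  -- Abstracting the list and the index leaves the metavariable applied to distinct variables, which
  -- is what pattern unification requires.
  sumIdx-∷ g x xs with x ∷ xs | 1
  ... | L | i = refl

-- The local helper carries the list of the outer call as a parameter. The two sides stem from
-- different outer calls, hence `L` and `L′`.
sumIdxFrom-++ : ∀ g L L′ i xs y →
  sumIdxFrom g L i (xs ++ y ∷ []) ≡ sumIdxFrom g L′ i xs + g (i ℕ.+ length xs) y
sumIdxFrom-++ g L L′ i []       y rewrite ℕ.+-identityʳ i = ℚ.+-comm (g i y) 0ℚ
sumIdxFrom-++ g L L′ i (x ∷ xs) y rewrite ℕ.+-suc i (length xs) =
  trans (cong (_+_ (g i x)) (sumIdxFrom-++ g L L′ (suc i) xs y)) (sym (ℚ.+-assoc (g i x) _ _))

sumIdx-++ : ∀ g xs y → sumIdx g (xs ++ y ∷ []) ≡ sumIdx g xs + g (length xs) y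
sumIdx-++ g xs y = sumIdxFrom-++ g (xs ++ y ∷ []) xs 0 xs y

-- Recurrences for the Bernoulli and Euler numbers

length-bernList : ∀ m → length (bernList m) ≡ m
length-bernList zero    = refl
length-bernList (suc m) = begin
  length (bernList m ++ _)   ≡⟨ length-++ (bernList m) ⟩
  length (bernList m) ℕ.+ 1  ≡⟨ ℕ.+-comm _ 1 ⟩
  suc (length (bernList m))  ≡⟨ cong suc (length-bernList m) ⟩
  suc m                      ∎

length-eulerList : ∀ m → length (eulerList m) ≡ m
length-eulerList zero    = refl
length-eulerList (suc m) = begin
  length (eulerList m ++ _)   ≡⟨ length-++ (eulerList m) ⟩
  length (eulerList m) ℕ.+ 1  ≡⟨ ℕ.+-comm _ 1 ⟩
  suc (length (eulerList m))  ≡⟨ cong suc (length-eulerList m) ⟩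
  suc m                       ∎

sumIdx-bernList : ∀ g m → sumIdx g (bernList (suc m)) ≡ sumTo m (λ k → g k (B k))
sumIdx-bernList g zero    = ℚ.+-identityʳ (g 0 (B 0))
sumIdx-bernList g (suc m) = begin
  sumIdx g (bernList (suc m) ++ B (suc m) ∷ [])
    ≡⟨ sumIdx-++ g (bernList (suc m)) (B (suc m)) ⟩
  sumIdx g (bernList (suc m)) + g (length (bernList (suc m))) (B (suc m))
    ≡⟨ cong₂ (λ s k → s + g k (B (suc m))) (sumIdx-bernList g m) (length-bernList (suc m)) ⟩
  sumTo (suc m) (λ k → g k (B k)) ∎

sumIdx-eulerList : ∀ g m → sumIdx g (eulerList (suc m)) ≡ sumTo m (λ k → g k (E2 k))
sumIdx-eulerList g zero    = ℚ.+-identityʳ (g 0 (E2 0))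
sumIdx-eulerList g (suc m) = begin
  sumIdx g (eulerList (suc m) ++ E2 (suc m) ∷ [])
    ≡⟨ sumIdx-++ g (eulerList (suc m)) (E2 (suc m)) ⟩
  sumIdx g (eulerList (suc m)) + g (length (eulerList (suc m))) (E2 (suc m))
    ≡⟨ cong₂ (λ s k → s + g k (E2 (suc m))) (sumIdx-eulerList g m) (length-eulerList (suc m)) ⟩
  sumTo (suc m) (λ k → g k (E2 k)) ∎

bernNext-nonEmpty : ∀ xs m → length xs ≡ suc m →
  bernNext xs ≡ - (inv (suc (suc m)) * sumIdx (λ k b → fromℕ (suc (suc m) C k) * b) xs)
bernNext-nonEmpty (x ∷ xs) _ refl = refl

eulerNext-nonEmpty : ∀ xs m → length xs ≡ suc m →
  eulerNext xs ≡ - sumIdx (λ k e → fromℕ ((2 ℕ.* suc m) C (2 ℕ.* k)) * e) xs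
eulerNext-nonEmpty (x ∷ xs) _ refl = refl

nC0≡1 : ∀ n → n C 0 ≡ 1
nC0≡1 n = trans (nCk≡nC[n∸k] {0} {n} z≤n) (nCn≡1 n)

[1+n]Cn≡1+n : ∀ n → suc n C n ≡ suc n
[1+n]Cn≡1+n zero    = refl
[1+n]Cn≡1+n (suc n) = begin
  suc (suc n) C suc n         ≡⟨ nCk+nC[k+1]≡[n+1]C[k+1] (suc n) n ⟨
  suc n C n ℕ.+ suc n C suc n ≡⟨ cong₂ ℕ._+_ ([1+n]Cn≡1+n n) (nCn≡1 (suc n)) ⟩
  suc n ℕ.+ 1                 ≡⟨ ℕ.+-comm (suc n) 1 ⟩
  suc (suc n)                 ∎

bernoulli-sum : ∀ m → sumTo (suc m) (λ k → fromℕ (suc (suc m) C k) * B k) ≡ 0ℚ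
bernoulli-sum m = begin
  s + fromℕ (n C suc m) * B (suc m)
    ≡⟨ cong₂ (λ c b → s + fromℕ c * b) ([1+n]Cn≡1+n (suc m)) B-suc ⟩
  s + fromℕ n * (- (inv n * s))
    ≡⟨ solve 3 (λ s c i → s :+ c :* (:- (i :* s)) := s :+ (:- (i :* c :* s))) refl s (fromℕ n) (inv n) ⟩
  s + - (inv n * fromℕ n * s)
    ≡⟨ cong (λ c → s + - (c * s)) (inv-* n) ⟩
  s + - (1ℚ * s)
    ≡⟨ solve 1 (λ s → s :+ (:- (con 1ℚ :* s)) := con 0ℚ) refl s ⟩
  0ℚ ∎
  where
  n = suc (suc m)
  s = sumTo m (λ k → fromℕ (n C k) * B k)
  B-suc : B (suc m) ≡ - (inv n * s)
  B-suc = trans (bernNext-nonEmpty (bernList (suc m)) m (length-bernList (suc m)))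
                (cong (λ t → - (inv n * t)) (sumIdx-bernList _ m))

euler-sum : ∀ m → sumTo (suc m) (λ k → fromℕ ((2 ℕ.* suc m) C (2 ℕ.* k)) * E2 k) ≡ 0ℚ
euler-sum m = begin
  s + fromℕ (n C n) * E2 (suc m)
    ≡⟨ cong₂ (λ c e → s + fromℕ c * e) (nCn≡1 n) E2-suc ⟩
  s + 1ℚ * (- s)
    ≡⟨ solve 1 (λ s → s :+ con 1ℚ :* (:- s) := con 0ℚ) refl s ⟩
  0ℚ ∎
  where
  n = 2 ℕ.* suc m
  s = sumTo m (λ k → fromℕ (n C (2 ℕ.* k)) * E2 k)
  E2-suc : E2 (suc m) ≡ - s
  E2-suc = trans (eulerNext-nonEmpty (eulerList (suc m)) m (length-eulerList (suc m)))
                 (cong -_ (sumIdx-eulerList _ m))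

-- The ring of exponential generating functions

Seq : Set
Seq = ℕ → ℚ

infixl 6 _⊕_
infixl 7 _⋆_ _•_
infix  8 ⊖_

_⊕_ : Seq → Seq → Seq
(f ⊕ g) n = f n + g n

⊖_ : Seq → Seq
(⊖ f) n = - f n

_•_ : ℚ → Seq → Seq
(c • f) n = c * f n

𝟘 : Seq
𝟘 _ = 0ℚ

D : Seq → Seq
D f = f ∘ suc

-- f stands for Σ f(n) x^n / n!, so D is the derivative and the product obeys the Leibniz rule.
_⋆_ : Seq → Seq → Seq
(f ⋆ g) zero    = f 0 * g 0
(f ⋆ g) (suc n) = (D f ⋆ g) n + (f ⋆ D g) n

κ : ℚ → Seq
κ c zero    = c
κ c (suc n) = 0ℚ

⋆-cong : ∀ {f f′ g g′} → f ≗ f′ → g ≗ g′ → f ⋆ g ≗ f′ ⋆ g′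
⋆-cong f≗f′ g≗g′ zero    = cong₂ _*_ (f≗f′ 0) (g≗g′ 0)
⋆-cong f≗f′ g≗g′ (suc n) =
  cong₂ _+_ (⋆-cong (f≗f′ ∘ suc) g≗g′ n) (⋆-cong f≗f′ (g≗g′ ∘ suc) n)

⋆-comm : ∀ f g → f ⋆ g ≗ g ⋆ f
⋆-comm f g zero    = ℚ.*-comm (f 0) (g 0)
⋆-comm f g (suc n) =
  trans (cong₂ _+_ (⋆-comm (D f) g n) (⋆-comm f (D g) n))
        (ℚ.+-comm ((g ⋆ D f) n) ((D g ⋆ f) n))

⋆-distribʳ-⊕ : ∀ h f g → (f ⊕ g) ⋆ h ≗ f ⋆ h ⊕ g ⋆ h
⋆-distribʳ-⊕ h f g zero    = ℚ.*-distribʳ-+ (h 0) (f 0) (g 0)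
⋆-distribʳ-⊕ h f g (suc n) =
  trans (cong₂ _+_ (⋆-distribʳ-⊕ h (D f) (D g) n) (⋆-distribʳ-⊕ (D h) f g n))
        (+-interchange ((D f ⋆ h) n) ((D g ⋆ h) n) ((f ⋆ D h) n) ((g ⋆ D h) n))

⋆-distribˡ-⊕ : ∀ h f g → h ⋆ (f ⊕ g) ≗ h ⋆ f ⊕ h ⋆ g
⋆-distribˡ-⊕ h f g n = begin
  (h ⋆ (f ⊕ g)) n        ≡⟨ ⋆-comm h (f ⊕ g) n ⟩
  ((f ⊕ g) ⋆ h) n        ≡⟨ ⋆-distribʳ-⊕ h f g n ⟩
  (f ⋆ h) n + (g ⋆ h) n  ≡⟨ cong₂ _+_ (⋆-comm f h n) (⋆-comm g h n) ⟩
  (h ⋆ f) n + (h ⋆ g) n  ∎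

⋆-assoc : ∀ f g h → (f ⋆ g) ⋆ h ≗ f ⋆ (g ⋆ h)
⋆-assoc f g h zero    = ℚ.*-assoc (f 0) (g 0) (h 0)
⋆-assoc f g h (suc n) = begin
  ((D f ⋆ g ⊕ f ⋆ D g) ⋆ h) n + (f ⋆ g ⋆ D h) n
    ≡⟨ cong (_+ (f ⋆ g ⋆ D h) n) (⋆-distribʳ-⊕ h (D f ⋆ g) (f ⋆ D g) n) ⟩
  (D f ⋆ g ⋆ h) n + (f ⋆ D g ⋆ h) n + (f ⋆ g ⋆ D h) n
    ≡⟨ cong₂ _+_ (cong₂ _+_ (⋆-assoc (D f) g h n) (⋆-assoc f (D g) h n)) (⋆-assoc f g (D h) n) ⟩
  (D f ⋆ (g ⋆ h)) n + (f ⋆ (D g ⋆ h)) n + (f ⋆ (g ⋆ D h)) n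
    ≡⟨ ℚ.+-assoc ((D f ⋆ (g ⋆ h)) n) _ _ ⟩
  (D f ⋆ (g ⋆ h)) n + ((f ⋆ (D g ⋆ h)) n + (f ⋆ (g ⋆ D h)) n)
    ≡⟨ cong ((D f ⋆ (g ⋆ h)) n +_) (⋆-distribˡ-⊕ f (D g ⋆ h) (g ⋆ D h) n) ⟨
  (D f ⋆ (g ⋆ h)) n + (f ⋆ (D g ⋆ h ⊕ g ⋆ D h)) n ∎

•-⋆ : ∀ c f g → (c • f) ⋆ g ≗ c • (f ⋆ g)
•-⋆ c f g zero    = ℚ.*-assoc c (f 0) (g 0)
•-⋆ c f g (suc n) =
  trans (cong₂ _+_ (•-⋆ c (D f) g n) (•-⋆ c f (D g) n))
        (sym (ℚ.*-distribˡ-+ c ((D f ⋆ g) n) ((f ⋆ D g) n)))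

⋆-• : ∀ c f g → f ⋆ (c • g) ≗ c • (f ⋆ g)
⋆-• c f g n = begin
  (f ⋆ (c • g)) n  ≡⟨ ⋆-comm f (c • g) n ⟩
  ((c • g) ⋆ f) n  ≡⟨ •-⋆ c g f n ⟩
  c * (g ⋆ f) n    ≡⟨ cong (c *_) (⋆-comm g f n) ⟩
  c * (f ⋆ g) n    ∎

⋆-zeroˡ : ∀ g → 𝟘 ⋆ g ≗ 𝟘
⋆-zeroˡ g zero    = ℚ.*-zeroˡ (g 0)
⋆-zeroˡ g (suc n) = cong₂ _+_ (⋆-zeroˡ g n) (⋆-zeroˡ (D g) n)

κ-⋆ : ∀ c g → κ c ⋆ g ≗ c • g
κ-⋆ c g zero    = refl
κ-⋆ c g (suc n) = begin
  (𝟘 ⋆ g) n + (κ c ⋆ D g) n  ≡⟨ cong₂ _+_ (⋆-zeroˡ g n) (κ-⋆ c (D g) n) ⟩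
  0ℚ + c * g (suc n)         ≡⟨ ℚ.+-identityˡ _ ⟩
  c * g (suc n)              ∎

⋆-identityˡ : ∀ g → κ 1ℚ ⋆ g ≗ g
⋆-identityˡ g n = trans (κ-⋆ 1ℚ g n) (ℚ.*-identityˡ (g n))

⋆-identityʳ : ∀ g → g ⋆ κ 1ℚ ≗ g
⋆-identityʳ g n = trans (⋆-comm g (κ 1ℚ) n) (⋆-identityˡ g n)

⊕-⋆-isCommutativeRing : IsCommutativeRing _≗_ _⊕_ _⋆_ ⊖_ 𝟘 (κ 1ℚ)
⊕-⋆-isCommutativeRing = record
  { isRing = record
    { +-isAbelianGroup = Pointwise.isAbelianGroup ℕ ℚ.+-0-isAbelianGroup
    ; *-cong           = ⋆-cong
    ; *-assoc          = ⋆-assoc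
    ; *-identity       = ⋆-identityˡ , ⋆-identityʳ
    ; distrib          = ⋆-distribˡ-⊕ , ⋆-distribʳ-⊕
    }
  ; *-comm = ⋆-comm
  }

⊕-⋆-commutativeRing : CommutativeRing 0ℓ 0ℓ
⊕-⋆-commutativeRing = record { isCommutativeRing = ⊕-⋆-isCommutativeRing }

-- With constant series as solver coefficients, rational arithmetic such as ½ times 2 is carried out
-- inside identities between series.
κ-homomorphism : CommutativeRing.rawRing ℚ.+-*-commutativeRing
                 -Raw-AlmostCommutative⟶ fromCommutativeRing ⊕-⋆-commutativeRing
κ-homomorphism = record
  { ⟦_⟧    = κ
  ; +-homo = λ c d → λ { zero → refl ; (suc n) → refl }
  ; *-homo = λ c d n → sym (trans (κ-⋆ c (κ d) n) (•-κ c d n))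
  ; -‿homo = λ c → λ { zero → refl ; (suc n) → refl }
  ; 0-homo = λ { zero → refl ; (suc n) → refl }
  ; 1-homo = λ _ → refl
  }
  where
  •-κ : ∀ c d → c • κ d ≗ κ (c * d)
  •-κ c d zero    = refl
  •-κ c d (suc n) = ℚ.*-zeroʳ c

κ-≟ : ∀ c d → Maybe (κ c ≗ κ d)
κ-≟ c d = Maybe.map (λ c≡d n → cong (λ a → κ a n) c≡d) (dec⇒maybe (c ℚ.≟ d))

module Solver = RingSolver (CommutativeRing.rawRing ℚ.+-*-commutativeRing)
                           (fromCommutativeRing ⊕-⋆-commutativeRing) κ-homomorphism κ-≟

module ≗-Reasoning = SetoidReasoning (CommutativeRing.setoid ⊕-⋆-commutativeRing)
module Ring = CommutativeRing ⊕-⋆-commutativeRing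

-- The Leibniz form of `_⋆_` lets the ring laws be proved by induction without any sums; explicit
-- sums enter through this bridge, whose induction step is Pascal's rule.
⋆-binomial : ∀ n f g → (f ⋆ g) n ≡ sumTo n (λ k → fromℕ (n C k) * (f k * g (n ℕ.∸ k)))
⋆-binomial zero    f g = sym (ℚ.*-identityˡ (f 0 * g 0))
⋆-binomial (suc n) f g = begin
  (D f ⋆ g) n + (f ⋆ D g) n
    ≡⟨ cong₂ _+_ (⋆-binomial n (D f) g) (⋆-binomial n f (D g)) ⟩
  sumTo n (λ k → fromℕ (n C k) * t (suc k)) + sumTo n (λ k → fromℕ (n C k) * (f k * g (suc (n ℕ.∸ k))))
    ≡⟨ cong (sumTo n (λ k → fromℕ (n C k) * t (suc k)) +_)
            (sumTo-cong n λ k k≤n → cong (λ m → fromℕ (n C k) * (f k * g m)) (sym (ℕ.+-∸-assoc 1 k≤n))) ⟩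
  sumTo n (λ k → fromℕ (n C k) * t (suc k)) + sumTo n (λ k → fromℕ (n C k) * t k)
    ≡⟨ cong (sumTo n (λ k → fromℕ (n C k) * t (suc k)) +_) last-term ⟨
  sumTo n (λ k → fromℕ (n C k) * t (suc k)) + sumTo (suc n) (λ k → fromℕ (n C k) * t k)
    ≡⟨ cong (sumTo n (λ k → fromℕ (n C k) * t (suc k)) +_) (sumTo-suc n (λ k → fromℕ (n C k) * t k)) ⟩
  sumTo n (λ k → fromℕ (n C k) * t (suc k)) + (fromℕ (n C 0) * t 0 + sumTo n (λ k → fromℕ (n C suc k) * t (suc k)))
    ≡⟨ solve 3 (λ a b c → a :+ (b :+ c) := b :+ (a :+ c)) refl
         (sumTo n (λ k → fromℕ (n C k) * t (suc k))) (fromℕ (n C 0) * t 0) (sumTo n (λ k → fromℕ (n C suc k) * t (suc k))) ⟩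
  fromℕ (n C 0) * t 0 + (sumTo n (λ k → fromℕ (n C k) * t (suc k)) + sumTo n (λ k → fromℕ (n C suc k) * t (suc k)))
    ≡⟨ cong₂ _+_ (cong (λ c → fromℕ c * t 0) (trans (nC0≡1 n) (sym (nC0≡1 (suc n)))))
                 (sym (sumTo-+ n (λ k → fromℕ (n C k) * t (suc k)) (λ k → fromℕ (n C suc k) * t (suc k)))) ⟩
  fromℕ (suc n C 0) * t 0 + sumTo n (λ k → fromℕ (n C k) * t (suc k) + fromℕ (n C suc k) * t (suc k))
    ≡⟨ cong (fromℕ (suc n C 0) * t 0 +_) (sumTo-cong n λ k _ → pascal k) ⟩
  fromℕ (suc n C 0) * t 0 + sumTo n (λ k → fromℕ (suc n C suc k) * t (suc k))
    ≡⟨ sumTo-suc n (λ k → fromℕ (suc n C k) * t k) ⟨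
  sumTo (suc n) (λ k → fromℕ (suc n C k) * t k) ∎
  where
  t : Seq
  t k = f k * g (suc n ℕ.∸ k)
  last-term : sumTo (suc n) (λ k → fromℕ (n C k) * t k) ≡ sumTo n (λ k → fromℕ (n C k) * t k)
  last-term = sumTo-extend (λ k → fromℕ (n C k) * t k) (ℕ.n≤1+n n) λ k n<k →
    trans (cong (λ c → fromℕ c * t k) (k>n⇒nCk≡0 n<k)) (ℚ.*-zeroˡ (t k))
  pascal : ∀ k → fromℕ (n C k) * t (suc k) + fromℕ (n C suc k) * t (suc k) ≡ fromℕ (suc n C suc k) * t (suc k)
  pascal k = begin
    fromℕ (n C k) * t (suc k) + fromℕ (n C suc k) * t (suc k)
      ≡⟨ ℚ.*-distribʳ-+ (t (suc k)) (fromℕ (n C k)) (fromℕ (n C suc k)) ⟨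
    (fromℕ (n C k) + fromℕ (n C suc k)) * t (suc k)
      ≡⟨ cong (_* t (suc k)) (trans (sym (fromℕ-+ (n C k) (n C suc k))) (cong fromℕ (nCk+nC[k+1]≡[n+1]C[k+1] n k))) ⟩
    fromℕ (suc n C suc k) * t (suc k) ∎

-- S c is the substitution x ↦ c x.
S : ℚ → Seq → Seq
S c f zero    = f 0
S c f (suc n) = c * S c (D f) n

S-cong : ∀ c {f g} → f ≗ g → S c f ≗ S c g
S-cong c f≗g zero    = f≗g 0
S-cong c f≗g (suc n) = cong (c *_) (S-cong c (f≗g ∘ suc) n)

S-⊕ : ∀ c f g → S c (f ⊕ g) ≗ S c f ⊕ S c g
S-⊕ c f g zero    = refl
S-⊕ c f g (suc n) =
  trans (cong (c *_) (S-⊕ c (D f) (D g) n)) (ℚ.*-distribˡ-+ c (S c (D f) n) (S c (D g) n))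

S-⊖ : ∀ c f → S c (⊖ f) ≗ ⊖ S c f
S-⊖ c f zero    = refl
S-⊖ c f (suc n) = trans (cong (c *_) (S-⊖ c (D f) n)) (sym (ℚ.neg-distribʳ-* c (S c (D f) n)))

S-κ : ∀ c a → S c (κ a) ≗ κ a
S-κ c a zero    = refl
S-κ c a (suc n) = trans (cong (c *_) (S-𝟘 n)) (ℚ.*-zeroʳ c)
  where
  S-𝟘 : S c 𝟘 ≗ 𝟘
  S-𝟘 zero    = refl
  S-𝟘 (suc n) = trans (cong (c *_) (S-𝟘 n)) (ℚ.*-zeroʳ c)

S-⋆ : ∀ c f g → S c (f ⋆ g) ≗ S c f ⋆ S c g
S-⋆ c f g zero    = refl
S-⋆ c f g (suc n) = begin
  c * S c (D f ⋆ g ⊕ f ⋆ D g) n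
    ≡⟨ cong (c *_) (S-⊕ c (D f ⋆ g) (f ⋆ D g) n) ⟩
  c * (S c (D f ⋆ g) n + S c (f ⋆ D g) n)
    ≡⟨ cong (c *_) (cong₂ _+_ (S-⋆ c (D f) g n) (S-⋆ c f (D g) n)) ⟩
  c * ((S c (D f) ⋆ S c g) n + (S c f ⋆ S c (D g)) n)
    ≡⟨ ℚ.*-distribˡ-+ c ((S c (D f) ⋆ S c g) n) ((S c f ⋆ S c (D g)) n) ⟩
  c * (S c (D f) ⋆ S c g) n + c * (S c f ⋆ S c (D g)) n
    ≡⟨ cong₂ _+_ (•-⋆ c (S c (D f)) (S c g) n) (⋆-• c (S c f) (S c (D g)) n) ⟨
  ((c • S c (D f)) ⋆ S c g) n + (S c f ⋆ (c • S c (D g))) n ∎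

S-coefficient : ∀ m f n → S (fromℕ m) f n ≡ fromℕ (m ℕ.^ n) * f n
S-coefficient m f zero    = sym (ℚ.*-identityˡ (f 0))
S-coefficient m f (suc n) = begin
  fromℕ m * S (fromℕ m) (D f) n          ≡⟨ cong (fromℕ m *_) (S-coefficient m (D f) n) ⟩
  fromℕ m * (fromℕ (m ℕ.^ n) * f (suc n)) ≡⟨ ℚ.*-assoc (fromℕ m) (fromℕ (m ℕ.^ n)) (f (suc n)) ⟨
  fromℕ m * fromℕ (m ℕ.^ n) * f (suc n)   ≡⟨ cong (_* f (suc n)) (fromℕ-* m (m ℕ.^ n)) ⟨
  fromℕ (m ℕ.^ suc n) * f (suc n)         ∎

-- Parity

parity : ∀ n → (∃ λ k → n ≡ 2 ℕ.* k) ⊎ (∃ λ k → n ≡ suc (2 ℕ.* k))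
parity zero    = inj₁ (0 , refl)
parity (suc n) with parity n
... | inj₁ (k , n≡2k)   = inj₂ (k , cong suc n≡2k)
... | inj₂ (k , n≡1+2k) = inj₁ (suc k , trans (cong suc n≡1+2k) (sym (ℕ.*-suc 2 k)))

sign-suc : ∀ n → sign (suc n) ≡ - sign n
sign-suc zero          = refl
sign-suc (suc zero)    = refl
sign-suc (suc (suc n)) = sign-suc n

sign-2* : ∀ k → sign (2 ℕ.* k) ≡ 1ℚ
sign-2* zero    = refl
sign-2* (suc k) = trans (cong sign (ℕ.*-suc 2 k)) (sign-2* k)

S₋ : Seq → Seq
S₋ = S (- 1ℚ)

S₋-sign : ∀ f n → S₋ f n ≡ sign n * f n
S₋-sign f zero    = sym (ℚ.*-identityˡ (f 0))
S₋-sign f (suc n) = begin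
  - 1ℚ * S₋ (D f) n          ≡⟨ cong (- 1ℚ *_) (S₋-sign (D f) n) ⟩
  - 1ℚ * (sign n * f (suc n)) ≡⟨ solve 2 (λ s a → con (- 1ℚ) :* (s :* a) := (:- s) :* a) refl (sign n) (f (suc n)) ⟩
  - sign n * f (suc n)        ≡⟨ cong (_* f (suc n)) (sign-suc n) ⟨
  sign (suc n) * f (suc n)    ∎

Even : Seq → Set
Even f = ∀ k → f (suc (2 ℕ.* k)) ≡ 0ℚ

x≡-x⇒x≡0 : ∀ {x} → x ≡ - x → x ≡ 0ℚ
x≡-x⇒x≡0 {x} x≡-x = begin
  x              ≡⟨ solve 1 (λ x → x := con ½ :* (x :+ x)) refl x ⟩
  ½ * (x + x)    ≡⟨ cong (λ y → ½ * (x + y)) x≡-x ⟩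
  ½ * (x + - x)  ≡⟨ solve 1 (λ x → con ½ :* (x :+ (:- x)) := con 0ℚ) refl x ⟩
  0ℚ             ∎

-- Evenness is traded for invariance under x ↦ -x. As `S₋` is multiplicative, the parity of a
-- product then follows by rewriting instead of by inspecting convolution sums.
S₋-fixed⇒even : ∀ f → S₋ f ≗ f → Even f
S₋-fixed⇒even f fixed k = x≡-x⇒x≡0 (begin
  f n           ≡⟨ fixed n ⟨
  S₋ f n        ≡⟨ S₋-sign f n ⟩
  sign n * f n  ≡⟨ cong (_* f n) (trans (sign-suc (2 ℕ.* k)) (cong -_ (sign-2* k))) ⟩
  - 1ℚ * f n    ≡⟨ solve 1 (λ a → con (- 1ℚ) :* a := :- a) refl (f n) ⟩
  - f n         ∎)
  where n = suc (2 ℕ.* k)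

even⇒S₋-fixed : ∀ f → Even f → S₋ f ≗ f
even⇒S₋-fixed f even n with parity n
... | inj₁ (k , refl) = begin
  S₋ f (2 ℕ.* k)                  ≡⟨ S₋-sign f (2 ℕ.* k) ⟩
  sign (2 ℕ.* k) * f (2 ℕ.* k)    ≡⟨ cong (_* f (2 ℕ.* k)) (sign-2* k) ⟩
  1ℚ * f (2 ℕ.* k)                ≡⟨ ℚ.*-identityˡ (f (2 ℕ.* k)) ⟩
  f (2 ℕ.* k)                     ∎
... | inj₂ (k , refl) = begin
  S₋ f (suc (2 ℕ.* k))                      ≡⟨ S₋-sign f (suc (2 ℕ.* k)) ⟩
  sign (suc (2 ℕ.* k)) * f (suc (2 ℕ.* k))  ≡⟨ cong (sign (suc (2 ℕ.* k)) *_) (even k) ⟩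
  sign (suc (2 ℕ.* k)) * 0ℚ                 ≡⟨ ℚ.*-zeroʳ (sign (suc (2 ℕ.* k))) ⟩
  0ℚ                                        ≡⟨ even k ⟨
  f (suc (2 ℕ.* k))                         ∎

even-⋆ : ∀ f g → Even f → Even g → Even (f ⋆ g)
even-⋆ f g f-even g-even = S₋-fixed⇒even (f ⋆ g) λ n →
  trans (S-⋆ (- 1ℚ) f g n) (⋆-cong (even⇒S₋-fixed f f-even) (even⇒S₋-fixed g g-even) n)

-- spread f is Σ f(k) x^(2k) / (2k)!.
spread : Seq → Seq
spread f zero          = f 0
spread f (suc zero)    = 0ℚ
spread f (suc (suc n)) = spread (D f) n

spread-2* : ∀ f k → spread f (2 ℕ.* k) ≡ f k
spread-2* f zero    = refl
spread-2* f (suc k) = trans (cong (spread f) (ℕ.*-suc 2 k)) (spread-2* (D f) k)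

spread-even : ∀ f → Even (spread f)
spread-even f zero    = refl
spread-even f (suc k) = trans (cong (spread f ∘ suc) (ℕ.*-suc 2 k)) (spread-even (D f) k)

-- The generating functions

X exp exp⁻ cosh sech : Seq
X zero    = 0ℚ
X (suc n) = κ 1ℚ n
exp _     = 1ℚ
exp⁻      = S₋ exp
cosh      = spread exp
sech      = spread E2

X-⋆ : ∀ f n → (X ⋆ f) (suc n) ≡ fromℕ (suc n) * f n
X-⋆ f zero    = solve 2 (λ a b → con 1ℚ :* a :+ con 0ℚ :* b := con 1ℚ :* a) refl (f 0) (f 1)
X-⋆ f (suc n) = begin
  (κ 1ℚ ⋆ f) (suc n) + (X ⋆ D f) (suc n)       ≡⟨ cong₂ _+_ (κ-⋆ 1ℚ f (suc n)) (X-⋆ (D f) n) ⟩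
  1ℚ * f (suc n) + fromℕ (suc n) * f (suc n)   ≡⟨ ℚ.*-distribʳ-+ (f (suc n)) 1ℚ (fromℕ (suc n)) ⟨
  (1ℚ + fromℕ (suc n)) * f (suc n)             ≡⟨ cong (_* f (suc n)) (fromℕ-suc (suc n)) ⟨
  fromℕ (suc (suc n)) * f (suc n)              ∎

X-⋆-injective : ∀ f → X ⋆ f ≗ 𝟘 → f ≗ 𝟘
X-⋆-injective f eq n = *-cancelˡ-fromℕ (suc n) (begin
  fromℕ (suc n) * f n  ≡⟨ X-⋆ f n ⟨
  (X ⋆ f) (suc n)      ≡⟨ eq (suc n) ⟩
  0ℚ                   ≡⟨ ℚ.*-zeroʳ (fromℕ (suc n)) ⟨
  fromℕ (suc n) * 0ℚ   ∎)

S-X : ∀ c → S c X ≗ κ c ⋆ X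
S-X c zero    = sym (ℚ.*-zeroʳ c)
S-X c (suc n) = trans (cong (c *_) (S-κ c 1ℚ n)) (sym (κ-⋆ c X (suc n)))

-- This is x = (e^x - 1) B(x) without the subtraction. The coefficients at 0 and 1, the latter being
-- where `X` contributes, are computed; the others are the Bernoulli recurrence.
bernoulli-gf : B ⋆ exp ≗ B ⊕ X
bernoulli-gf zero          = refl
bernoulli-gf (suc zero)    = refl
bernoulli-gf (suc (suc m)) = begin
  (B ⋆ exp) n
    ≡⟨ ⋆-binomial n B exp ⟩
  sumTo n (λ k → fromℕ (n C k) * (B k * 1ℚ))
    ≡⟨ sumTo-cong n (λ k _ → cong (fromℕ (n C k) *_) (ℚ.*-identityʳ (B k))) ⟩
  sumTo (suc m) (λ k → fromℕ (n C k) * B k) + fromℕ (n C n) * B n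
    ≡⟨ cong₂ (λ s c → s + fromℕ c * B n) (bernoulli-sum m) (nCn≡1 n) ⟩
  0ℚ + 1ℚ * B n
    ≡⟨ solve 1 (λ b → con 0ℚ :+ con 1ℚ :* b := b :+ con 0ℚ) refl (B n) ⟩
  B n + 0ℚ ∎
  where n = suc (suc m)

-- Replacing x by ix in sec x absorbs the signs (-1)^j, so the unsigned `spread E2` is the inverse
-- of cosh. Odd coefficients vanish by parity, even ones by the Euler recurrence.
sech-cosh : sech ⋆ cosh ≗ κ 1ℚ
sech-cosh n with parity n
... | inj₂ (k , refl)     = even-⋆ sech cosh (spread-even E2) (spread-even exp) k
... | inj₁ (zero , refl)  = refl
... | inj₁ (suc m , refl) = begin
  (sech ⋆ cosh) (2 ℕ.* suc m)
    ≡⟨ ⋆-binomial (2 ℕ.* suc m) sech cosh ⟩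
  sumTo (2 ℕ.* suc m) (λ k → fromℕ ((2 ℕ.* suc m) C k) * (sech k * cosh (2 ℕ.* suc m ℕ.∸ k)))
    ≡⟨ sumTo-evens (suc m) _ (λ k _ → *-zero-middle (fromℕ ((2 ℕ.* suc m) C suc (2 ℕ.* k))) (cosh (2 ℕ.* suc m ℕ.∸ suc (2 ℕ.* k))) (spread-even E2 k)) ⟩
  sumTo (suc m) (λ k → fromℕ ((2 ℕ.* suc m) C (2 ℕ.* k)) * (sech (2 ℕ.* k) * cosh (2 ℕ.* suc m ℕ.∸ 2 ℕ.* k)))
    ≡⟨ sumTo-cong (suc m) (λ k _ → cong (fromℕ ((2 ℕ.* suc m) C (2 ℕ.* k)) *_) (term k)) ⟩
  sumTo (suc m) (λ k → fromℕ ((2 ℕ.* suc m) C (2 ℕ.* k)) * E2 k)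
    ≡⟨ euler-sum m ⟩
  0ℚ ∎
  where
  term : ∀ k → sech (2 ℕ.* k) * cosh (2 ℕ.* suc m ℕ.∸ 2 ℕ.* k) ≡ E2 k
  term k = begin
    sech (2 ℕ.* k) * cosh (2 ℕ.* suc m ℕ.∸ 2 ℕ.* k)
      ≡⟨ cong₂ _*_ (spread-2* E2 k) (trans (cong cosh (sym (ℕ.*-distribˡ-∸ 2 (suc m) k))) (spread-2* exp (suc m ℕ.∸ k))) ⟩
    E2 k * 1ℚ
      ≡⟨ ℚ.*-identityʳ (E2 k) ⟩
    E2 k ∎

2ℚ : ℚ
2ℚ = fromℕ 2

S-2-exp : S 2ℚ exp ≗ exp ⋆ exp
S-2-exp zero    = refl
S-2-exp (suc n) = trans (cong (2ℚ *_) (S-2-exp n))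
  (solve 1 (λ a → con 2ℚ :* a := a :+ a) refl ((exp ⋆ exp) n))

exp-exp⁻ : exp ⋆ exp⁻ ≗ κ 1ℚ
exp-exp⁻ zero    = refl
exp-exp⁻ (suc n) = trans (cong ((exp ⋆ exp⁻) n +_) (⋆-• (- 1ℚ) exp exp⁻ n))
  (solve 1 (λ a → a :+ con (- 1ℚ) :* a := con 0ℚ) refl ((exp ⋆ exp⁻) n))

exp-+-exp⁻ : exp ⊕ exp⁻ ≗ cosh ⊕ cosh
exp-+-exp⁻ zero          = refl
exp-+-exp⁻ (suc zero)    = refl
exp-+-exp⁻ (suc (suc n)) = trans
  (solve 1 (λ a → con 1ℚ :+ con (- 1ℚ) :* (con (- 1ℚ) :* a) := con 1ℚ :+ a) refl (exp⁻ n))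
  (exp-+-exp⁻ n)

-- The series -x / (e^x + 1) and its even part

-- The coefficients (2^m - 1) B_m are the Genocchi numbers up to the factor -1/2.
G : Seq
G = S 2ℚ B ⊕ ⊖ B

-- Formally 2x / (e^(2x) - 1) · (e^x + 1) = 2x / (e^x - 1). Division by e^x - 1 is avoided: the
-- difference `Y` of the two sides is multiplied by `X`, which equals B(x) (e^x - 1), and
-- multiplication by `X` is injective.
S-2-bernoulli : S 2ℚ B ⋆ (exp ⊕ κ 1ℚ) ≗ B ⊕ B
S-2-bernoulli n = begin
  f n                ≡⟨ solve 2 (λ a b → a := (a :+ (:- b)) :+ b) refl (f n) ((B ⊕ B) n) ⟩
  Y n + (B ⊕ B) n    ≡⟨ cong (_+ (B ⊕ B) n) (X-⋆-injective Y X⋆Y n) ⟩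
  0ℚ + (B ⊕ B) n     ≡⟨ ℚ.+-identityˡ ((B ⊕ B) n) ⟩
  (B ⊕ B) n          ∎
  where
  f = S 2ℚ B ⋆ (exp ⊕ κ 1ℚ)
  Y = f ⊕ ⊖ (B ⊕ B)
  S-2-gf : S 2ℚ B ⋆ (exp ⋆ exp) ≗ S 2ℚ B ⊕ κ 2ℚ ⋆ X
  S-2-gf = R.begin
    S 2ℚ B ⋆ (exp ⋆ exp) R.≈⟨ ⋆-cong {S 2ℚ B} (λ _ → refl) S-2-exp ⟨
    S 2ℚ B ⋆ S 2ℚ exp    R.≈⟨ S-⋆ 2ℚ B exp ⟨
    S 2ℚ (B ⋆ exp)       R.≈⟨ S-cong 2ℚ bernoulli-gf ⟩
    S 2ℚ (B ⊕ X)         R.≈⟨ S-⊕ 2ℚ B X ⟩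
    S 2ℚ B ⊕ S 2ℚ X      R.≈⟨ (λ n → cong (S 2ℚ B n +_) (S-X 2ℚ n)) ⟩
    S 2ℚ B ⊕ κ 2ℚ ⋆ X    R.∎
    where module R = ≗-Reasoning
  module N = Solver
  X⋆Y : X ⋆ Y ≗ 𝟘
  X⋆Y = R.begin
    X ⋆ Y
      -- The inserted `b - b` prepares the factor x for replacement by B(x) e^x - B(x).
      R.≈⟨ N.solve 4 (λ x b s e → x N.:* (s N.:* (e N.:+ N.con 1ℚ) N.:- (b N.:+ b))
                        N.:= (x N.:+ b N.:- b) N.:* (s N.:* (e N.:+ N.con 1ℚ) N.:- (b N.:+ b))) (λ _ → refl) X B (S 2ℚ B) exp ⟩
    (X ⊕ B ⊕ ⊖ B) ⋆ Y
      R.≈⟨ ⋆-cong {g = Y} (λ n → cong (_+ - B n) (trans (ℚ.+-comm (X n) (B n)) (sym (bernoulli-gf n)))) (λ _ → refl) ⟩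
    (B ⋆ exp ⊕ ⊖ B) ⋆ Y
      R.≈⟨ N.solve 3 (λ b s e → (b N.:* e N.:- b) N.:* (s N.:* (e N.:+ N.con 1ℚ) N.:- (b N.:+ b))
                        N.:= b N.:* ((s N.:* (e N.:* e) N.:- s) N.:- N.con 2ℚ N.:* (b N.:* e N.:- b))) (λ _ → refl) B (S 2ℚ B) exp ⟩
    B ⋆ (S 2ℚ B ⋆ (exp ⋆ exp) ⊕ ⊖ S 2ℚ B ⊕ ⊖ (κ 2ℚ ⋆ (B ⋆ exp ⊕ ⊖ B)))
      R.≈⟨ Ring.*-congˡ {B} (Ring.+-cong (Ring.+-congʳ {⊖ S 2ℚ B} S-2-gf) (Ring.-‿cong (Ring.*-congˡ {κ 2ℚ} (Ring.+-congʳ {⊖ B} bernoulli-gf)))) ⟩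
    B ⋆ (S 2ℚ B ⊕ κ 2ℚ ⋆ X ⊕ ⊖ S 2ℚ B ⊕ ⊖ (κ 2ℚ ⋆ (B ⊕ X ⊕ ⊖ B)))
      R.≈⟨ N.solve 3 (λ x b s → b N.:* ((s N.:+ N.con 2ℚ N.:* x N.:- s) N.:- N.con 2ℚ N.:* (b N.:+ x N.:- b)) N.:= N.con 0ℚ) (λ _ → refl) X B (S 2ℚ B) ⟩
    κ 0ℚ
      R.≈⟨ (λ { zero → refl ; (suc n) → refl }) ⟩
    𝟘 R.∎
    where module R = ≗-Reasoning

G-gf : G ⋆ (exp ⊕ κ 1ℚ) ≗ ⊖ X
G-gf = R.begin
  G ⋆ (exp ⊕ κ 1ℚ)
    R.≈⟨ N.solve 3 (λ b s e → (s N.:- b) N.:* (e N.:+ N.con 1ℚ) N.:= s N.:* (e N.:+ N.con 1ℚ) N.:- b N.:* e N.:- b) (λ _ → refl) B (S 2ℚ B) exp ⟩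
  S 2ℚ B ⋆ (exp ⊕ κ 1ℚ) ⊕ ⊖ (B ⋆ exp) ⊕ ⊖ B
    R.≈⟨ Ring.+-congʳ {⊖ B} (Ring.+-cong S-2-bernoulli (Ring.-‿cong bernoulli-gf)) ⟩
  B ⊕ B ⊕ ⊖ (B ⊕ X) ⊕ ⊖ B
    R.≈⟨ N.solve 2 (λ b x → b N.:+ b N.:- (b N.:+ x) N.:- b N.:= N.:- x) (λ _ → refl) B X ⟩
  ⊖ X R.∎
  where
  module N = Solver
  module R = ≗-Reasoning

-- Since e^x · 2 cosh x = e^(2x) + 1, multiplying by 1 = sech x cosh x and by 1 = e^x e^(-x)
-- produces the factor e^(2x) + 1 that `G-gf`, taken at 2x, can absorb.
S-2-G : S 2ℚ G ≗ ⊖ (X ⋆ (sech ⋆ exp⁻))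
S-2-G = R.begin
  g
    R.≈⟨ N.solve 1 (λ g → g N.:= g N.:* N.con 1ℚ N.:* N.con 1ℚ) (λ _ → refl) g ⟩
  g ⋆ κ 1ℚ ⋆ κ 1ℚ
    R.≈⟨ Ring.*-cong (Ring.*-congˡ {g} sech-cosh) exp-exp⁻ ⟨
  g ⋆ (sech ⋆ cosh) ⋆ (exp ⋆ exp⁻)
    R.≈⟨ N.solve 5 (λ g h c e e⁻ → g N.:* (h N.:* c) N.:* (e N.:* e⁻)
                      N.:= N.con ½ N.:* (g N.:* e N.:* (c N.:+ c)) N.:* (h N.:* e⁻)) (λ _ → refl) g sech cosh exp exp⁻ ⟩
  κ ½ ⋆ (g ⋆ exp ⋆ (cosh ⊕ cosh)) ⋆ (sech ⋆ exp⁻)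
    R.≈⟨ Ring.*-congʳ {sech ⋆ exp⁻} (Ring.*-congˡ {κ ½} (Ring.*-congˡ {g ⋆ exp} exp-+-exp⁻)) ⟨
  κ ½ ⋆ (g ⋆ exp ⋆ (exp ⊕ exp⁻)) ⋆ (sech ⋆ exp⁻)
    R.≈⟨ N.solve 4 (λ g h e e⁻ → N.con ½ N.:* (g N.:* e N.:* (e N.:+ e⁻)) N.:* (h N.:* e⁻)
                      N.:= N.con ½ N.:* (g N.:* (e N.:* e N.:+ e N.:* e⁻)) N.:* (h N.:* e⁻)) (λ _ → refl) g sech exp exp⁻ ⟩
  κ ½ ⋆ (g ⋆ (exp ⋆ exp ⊕ exp ⋆ exp⁻)) ⋆ (sech ⋆ exp⁻)
    R.≈⟨ Ring.*-congʳ {sech ⋆ exp⁻} (Ring.*-congˡ {κ ½} g-gf) ⟩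
  κ ½ ⋆ (⊖ (κ 2ℚ ⋆ X)) ⋆ (sech ⋆ exp⁻)
    R.≈⟨ N.solve 2 (λ x h → N.con ½ N.:* (N.:- (N.con 2ℚ N.:* x)) N.:* h N.:= N.:- (x N.:* h)) (λ _ → refl) X (sech ⋆ exp⁻) ⟩
  ⊖ (X ⋆ (sech ⋆ exp⁻)) R.∎
  where
  module N = Solver
  module R = ≗-Reasoning
  g = S 2ℚ G
  g-gf : g ⋆ (exp ⋆ exp ⊕ exp ⋆ exp⁻) ≗ ⊖ (κ 2ℚ ⋆ X)
  g-gf = R.begin
    g ⋆ (exp ⋆ exp ⊕ exp ⋆ exp⁻)     R.≈⟨ Ring.*-congˡ {g} (Ring.+-congˡ {exp ⋆ exp} exp-exp⁻) ⟩
    g ⋆ (exp ⋆ exp ⊕ κ 1ℚ)           R.≈⟨ Ring.*-congˡ {g} (Ring.+-cong S-2-exp (S-κ 2ℚ 1ℚ)) ⟨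
    g ⋆ (S 2ℚ exp ⊕ S 2ℚ (κ 1ℚ))     R.≈⟨ Ring.*-congˡ {g} (S-⊕ 2ℚ exp (κ 1ℚ)) ⟨
    g ⋆ S 2ℚ (exp ⊕ κ 1ℚ)            R.≈⟨ S-⋆ 2ℚ G (exp ⊕ κ 1ℚ) ⟨
    S 2ℚ (G ⋆ (exp ⊕ κ 1ℚ))          R.≈⟨ S-cong 2ℚ G-gf ⟩
    S 2ℚ (⊖ X)                       R.≈⟨ S-⊖ 2ℚ X ⟩
    ⊖ S 2ℚ X                         R.≈⟨ Ring.-‿cong (S-X 2ℚ) ⟩
    ⊖ (κ 2ℚ ⋆ X)                     R.∎

-- Adding X/2 removes the only nonzero odd coefficient of G.
G₀ : Seq
G₀ = G ⊕ κ ½ ⋆ X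

S₋-exp⁻ : S₋ exp⁻ ≗ exp
S₋-exp⁻ zero    = refl
S₋-exp⁻ (suc n) = begin
  - 1ℚ * S₋ (- 1ℚ • exp⁻) n     ≡⟨ cong (- 1ℚ *_) (S-• n exp⁻) ⟩
  - 1ℚ * (- 1ℚ * S₋ exp⁻ n)     ≡⟨ solve 1 (λ a → con (- 1ℚ) :* (con (- 1ℚ) :* a) := a) refl (S₋ exp⁻ n) ⟩
  S₋ exp⁻ n                     ≡⟨ S₋-exp⁻ n ⟩
  1ℚ                            ∎
  where
  S-• : ∀ n f → S₋ (- 1ℚ • f) n ≡ - 1ℚ * S₋ f n
  S-• zero    f = refl
  S-• (suc n) f = cong (- 1ℚ *_) (S-• n (D f))

-- The right-hand side is x tanh x, because 1 - e^(-x) / cosh x = sinh x / cosh x.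
S-2-G₀ : S 2ℚ G₀ ≗ X ⋆ (κ 1ℚ ⊕ ⊖ (sech ⋆ exp⁻))
S-2-G₀ = R.begin
  S 2ℚ G₀
    R.≈⟨ S-⊕ 2ℚ G (κ ½ ⋆ X) ⟩
  S 2ℚ G ⊕ S 2ℚ (κ ½ ⋆ X)
    R.≈⟨ Ring.+-cong S-2-G (λ n → trans (S-⋆ 2ℚ (κ ½) X n) (⋆-cong (S-κ 2ℚ ½) (S-X 2ℚ) n)) ⟩
  ⊖ (X ⋆ (sech ⋆ exp⁻)) ⊕ κ ½ ⋆ (κ 2ℚ ⋆ X)
    R.≈⟨ N.solve 2 (λ x h → N.:- (x N.:* h) N.:+ N.con ½ N.:* (N.con 2ℚ N.:* x) N.:= x N.:* (N.con 1ℚ N.:- h)) (λ _ → refl) X (sech ⋆ exp⁻) ⟩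
  X ⋆ (κ 1ℚ ⊕ ⊖ (sech ⋆ exp⁻)) R.∎
  where
  module N = Solver
  module R = ≗-Reasoning

S-2-G₀-even : Even (S 2ℚ G₀)
S-2-G₀-even = S₋-fixed⇒even (S 2ℚ G₀) (R.begin
  S₋ (S 2ℚ G₀)
    R.≈⟨ S-cong (- 1ℚ) S-2-G₀ ⟩
  S₋ (X ⋆ (κ 1ℚ ⊕ ⊖ (sech ⋆ exp⁻)))
    R.≈⟨ S-⋆ (- 1ℚ) X (κ 1ℚ ⊕ ⊖ (sech ⋆ exp⁻)) ⟩
  S₋ X ⋆ S₋ (κ 1ℚ ⊕ ⊖ (sech ⋆ exp⁻))
    R.≈⟨ Ring.*-cong (S-X (- 1ℚ)) (S-⊕ (- 1ℚ) (κ 1ℚ) (⊖ (sech ⋆ exp⁻))) ⟩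
  κ (- 1ℚ) ⋆ X ⋆ (S₋ (κ 1ℚ) ⊕ S₋ (⊖ (sech ⋆ exp⁻)))
    R.≈⟨ Ring.*-congˡ {κ (- 1ℚ) ⋆ X} (Ring.+-cong (S-κ (- 1ℚ) 1ℚ) (R.begin
           S₋ (⊖ (sech ⋆ exp⁻))  R.≈⟨ S-⊖ (- 1ℚ) (sech ⋆ exp⁻) ⟩
           ⊖ S₋ (sech ⋆ exp⁻)    R.≈⟨ Ring.-‿cong (S-⋆ (- 1ℚ) sech exp⁻) ⟩
           ⊖ (S₋ sech ⋆ S₋ exp⁻) R.≈⟨ Ring.-‿cong (Ring.*-cong (even⇒S₋-fixed sech (spread-even E2)) S₋-exp⁻) ⟩
           ⊖ (sech ⋆ exp)        R.∎)) ⟩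
  κ (- 1ℚ) ⋆ X ⋆ (κ 1ℚ ⊕ ⊖ (sech ⋆ exp))
    -- Adding and subtracting sech x e^(-x) creates sech x (e^x + e^(-x)), which equals 2; this is
    -- the oddness of tanh.
    R.≈⟨ N.solve 4 (λ x h e e⁻ → N.con (- 1ℚ) N.:* x N.:* (N.con 1ℚ N.:- h N.:* e)
                      N.:= x N.:* (h N.:* (e N.:+ e⁻) N.:- N.con 1ℚ N.:- h N.:* e⁻)) (λ _ → refl) X sech exp exp⁻ ⟩
  X ⋆ (sech ⋆ (exp ⊕ exp⁻) ⊕ ⊖ κ 1ℚ ⊕ ⊖ (sech ⋆ exp⁻))
    R.≈⟨ Ring.*-congˡ {X} (Ring.+-congʳ {⊖ (sech ⋆ exp⁻)} (Ring.+-congʳ {⊖ κ 1ℚ} (R.begin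
           sech ⋆ (exp ⊕ exp⁻)        R.≈⟨ Ring.*-congˡ {sech} exp-+-exp⁻ ⟩
           sech ⋆ (cosh ⊕ cosh)       R.≈⟨ ⋆-distribˡ-⊕ sech cosh cosh ⟩
           sech ⋆ cosh ⊕ sech ⋆ cosh  R.≈⟨ Ring.+-cong sech-cosh sech-cosh ⟩
           κ 1ℚ ⊕ κ 1ℚ                R.∎))) ⟩
  X ⋆ (κ 1ℚ ⊕ κ 1ℚ ⊕ ⊖ κ 1ℚ ⊕ ⊖ (sech ⋆ exp⁻))
    R.≈⟨ N.solve 2 (λ x h → x N.:* (N.con 1ℚ N.:+ N.con 1ℚ N.:- N.con 1ℚ N.:- h) N.:= x N.:* (N.con 1ℚ N.:- h)) (λ _ → refl) X (sech ⋆ exp⁻) ⟩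
  X ⋆ (κ 1ℚ ⊕ ⊖ (sech ⋆ exp⁻))
    R.≈⟨ S-2-G₀ ⟨
  S 2ℚ G₀ R.∎)
  where
  module N = Solver
  module R = ≗-Reasoning

G₀-even : Even G₀
G₀-even k = *-cancelˡ-fromℕ (2 ℕ.^ suc (2 ℕ.* k)) {{ℕ.m^n≢0 2 (suc (2 ℕ.* k))}} (begin
  fromℕ (2 ℕ.^ suc (2 ℕ.* k)) * G₀ (suc (2 ℕ.* k))  ≡⟨ S-coefficient 2 G₀ (suc (2 ℕ.* k)) ⟨
  S 2ℚ G₀ (suc (2 ℕ.* k))                           ≡⟨ S-2-G₀-even k ⟩
  0ℚ                                                ≡⟨ ℚ.*-zeroʳ (fromℕ (2 ℕ.^ suc (2 ℕ.* k))) ⟨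
  fromℕ (2 ℕ.^ suc (2 ℕ.* k)) * 0ℚ                  ∎)

G₀-2* : ∀ m → G₀ (2 ℕ.* m) ≡ fromℕ (2 ℕ.^ (2 ℕ.* m) ℕ.∸ 1) * B (2 ℕ.* m)
G₀-2* m = begin
  S 2ℚ B n + - B n + (κ ½ ⋆ X) n
    ≡⟨ cong₂ (λ s t → s + - B n + t) (S-coefficient 2 B n) (trans (κ-⋆ ½ X n) (trans (cong (½ *_) (X-2* m)) (ℚ.*-zeroʳ ½))) ⟩
  fromℕ (2 ℕ.^ n) * B n + - B n + 0ℚ
    ≡⟨ cong (λ a → fromℕ a * B n + - B n + 0ℚ) (ℕ.m+[n∸m]≡n (ℕ.m^n>0 2 n)) ⟨
  fromℕ (1 ℕ.+ (2 ℕ.^ n ℕ.∸ 1)) * B n + - B n + 0ℚ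
    ≡⟨ cong (λ a → a * B n + - B n + 0ℚ) (fromℕ-suc (2 ℕ.^ n ℕ.∸ 1)) ⟩
  (1ℚ + fromℕ (2 ℕ.^ n ℕ.∸ 1)) * B n + - B n + 0ℚ
    ≡⟨ solve 2 (λ a b → (con 1ℚ :+ a) :* b :+ (:- b) :+ con 0ℚ := a :* b) refl (fromℕ (2 ℕ.^ n ℕ.∸ 1)) (B n) ⟩
  fromℕ (2 ℕ.^ n ℕ.∸ 1) * B n ∎
  where
  n = 2 ℕ.* m
  X-2* : ∀ m → X (2 ℕ.* m) ≡ 0ℚ
  X-2* zero    = refl
  X-2* (suc m) = cong X (ℕ.*-suc 2 m)

-- Binomial coefficients

[1+k]*[1+n]C[1+k] : ∀ n k → suc k ℕ.* (suc n C suc k) ≡ suc n ℕ.* (n C k)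
[1+k]*[1+n]C[1+k] zero    zero    = refl
[1+k]*[1+n]C[1+k] zero    (suc k) = trans (cong (suc (suc k) ℕ.*_) (k>n⇒nCk≡0 {1} {suc (suc k)} (s≤s (s≤s z≤n)))) (ℕ.*-zeroʳ (suc (suc k)))
[1+k]*[1+n]C[1+k] (suc n) zero    = begin
  1 ℕ.* (suc (suc n) C 1)            ≡⟨ ℕ.*-identityˡ (suc (suc n) C 1) ⟩
  suc (suc n) C 1                    ≡⟨ nC1≡n (suc (suc n)) ⟩
  suc (suc n)                        ≡⟨ ℕ.*-identityʳ (suc (suc n)) ⟨
  suc (suc n) ℕ.* 1                  ≡⟨ cong (suc (suc n) ℕ.*_) (nC0≡1 (suc n)) ⟨
  suc (suc n) ℕ.* (suc n C 0)        ∎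
[1+k]*[1+n]C[1+k] (suc n) (suc k) = begin
  (2 ℕ.+ k) ℕ.* (suc (suc n) C suc (suc k))
    ≡⟨ cong ((2 ℕ.+ k) ℕ.*_) (nCk+nC[k+1]≡[n+1]C[k+1] (suc n) (suc k)) ⟨
  (2 ℕ.+ k) ℕ.* (a ℕ.+ b)
    ≡⟨ N.solve 3 (λ k a b → (N.con 2 N.:+ k) N.:* (a N.:+ b) N.:= a N.:+ (N.con 1 N.:+ k) N.:* a N.:+ (N.con 2 N.:+ k) N.:* b) refl k a b ⟩
  a ℕ.+ suc k ℕ.* a ℕ.+ (2 ℕ.+ k) ℕ.* b
    ≡⟨ cong₂ (λ x y → a ℕ.+ x ℕ.+ y) ([1+k]*[1+n]C[1+k] n k) ([1+k]*[1+n]C[1+k] n (suc k)) ⟩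
  a ℕ.+ suc n ℕ.* (n C k) ℕ.+ suc n ℕ.* (n C suc k)
    ≡⟨ N.solve 4 (λ a m x y → a N.:+ m N.:* x N.:+ m N.:* y N.:= a N.:+ m N.:* (x N.:+ y)) refl a (suc n) (n C k) (n C suc k) ⟩
  a ℕ.+ suc n ℕ.* (n C k ℕ.+ n C suc k)
    ≡⟨ cong (λ x → a ℕ.+ suc n ℕ.* x) (nCk+nC[k+1]≡[n+1]C[k+1] n k) ⟩
  suc (suc n) ℕ.* (suc n C suc k) ∎
  where
  module N = ℕSolver.+-*-Solver
  a = suc n C suc k
  b = suc n C suc (suc k)

[1+n∸k]*[1+n]Ck : ∀ n k → k ≤ n → suc (n ℕ.∸ k) ℕ.* (suc n C k) ≡ suc n ℕ.* (n C k)
[1+n∸k]*[1+n]Ck n k k≤n = begin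
  suc (n ℕ.∸ k) ℕ.* (suc n C k)
    ≡⟨ cong (suc (n ℕ.∸ k) ℕ.*_) (nCk≡nC[n∸k] (ℕ.m≤n⇒m≤1+n k≤n)) ⟩
  suc (n ℕ.∸ k) ℕ.* (suc n C (suc n ℕ.∸ k))
    ≡⟨ cong (λ m → suc (n ℕ.∸ k) ℕ.* (suc n C m)) (ℕ.+-∸-assoc 1 k≤n) ⟩
  suc (n ℕ.∸ k) ℕ.* (suc n C suc (n ℕ.∸ k))
    ≡⟨ [1+k]*[1+n]C[1+k] n (n ℕ.∸ k) ⟩
  suc n ℕ.* (n C (n ℕ.∸ k))
    ≡⟨ cong (suc n ℕ.*_) (nCk≡nC[n∸k] k≤n) ⟨
  suc n ℕ.* (n C k) ∎

-- It says that 2z - 1 has residue 0 against a pole of order at least two, which starts the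
-- induction in `shear-Φ`.
central-binomial : ∀ n → (2 ℕ.* suc n) C suc n ≡ 2 ℕ.* ((2 ℕ.* suc n ℕ.∸ 1) C suc n)
central-binomial n = begin
  (2 ℕ.* suc n) C suc n    ≡⟨ nCk+nC[k+1]≡[n+1]C[k+1] m n ⟨
  m C n ℕ.+ m C suc n      ≡⟨ cong (ℕ._+ m C suc n) (trans (nCk≡nC[n∸k] (ℕ.m≤m+n n (suc n ℕ.+ 0))) (cong (m C_) m∸n)) ⟩
  m C suc n ℕ.+ m C suc n  ≡⟨ cong (m C suc n ℕ.+_) (ℕ.+-identityʳ (m C suc n)) ⟨
  2 ℕ.* (m C suc n)        ∎
  where
  m = n ℕ.+ (suc n ℕ.+ 0)
  m∸n : m ℕ.∸ n ≡ suc n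
  m∸n = trans (ℕ.m+n∸m≡n n (suc n ℕ.+ 0)) (ℕ.+-identityʳ (suc n))

-- Residues at zero of powers of z and of 2z - 1

-- φ d k is the coefficient of z^(d-1) in z^k (1 - z)^(-d), that is the
-- residue of z^k / (z (1 - z))^d at 0.
φ : ℕ → ℕ → ℕ
φ zero          k       = 0
φ (suc zero)    zero    = 1
φ (suc zero)    (suc k) = 0
φ (suc (suc e)) k       = (2 ℕ.* suc e ℕ.∸ k) C suc e

φ-binomial : ∀ e k → k ≤ e → φ (suc e) k ≡ (2 ℕ.* e ℕ.∸ k) C e
φ-binomial zero    .0 z≤n = refl
φ-binomial (suc e) k  _   = refl

-- A power z^k with k at least d cancels the pole. In the binomial formula, the upper entry falls
-- below the lower one.
φ-vanishes : ∀ e k → e < k → φ (suc e) k ≡ 0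
φ-vanishes zero    (suc k) _   = refl
φ-vanishes (suc e) k       e<k = k>n⇒nCk≡0 (s≤s (R.begin
  2 ℕ.* suc e ℕ.∸ k          R.≤⟨ ℕ.∸-monoʳ-≤ (2 ℕ.* suc e) e<k ⟩
  2 ℕ.* suc e ℕ.∸ (2 ℕ.+ e)  R.≡⟨ cong (ℕ._∸ (2 ℕ.+ e)) (ℕ.*-suc 2 e) ⟩
  2 ℕ.* e ℕ.∸ e              R.≡⟨ ℕ.m+n∸m≡n e (e ℕ.+ 0) ⟩
  e ℕ.+ 0                    R.≡⟨ ℕ.+-identityʳ e ⟩
  e                          R.∎))
  where module R = ℕ.≤-Reasoning

-- z^(k+1) - z^(k+2) = z^k · z (1 - z)
φ-suc : ∀ d k → φ (suc d) (suc k) ≡ φ (suc d) (suc (suc k)) ℕ.+ φ d k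
φ-suc zero                k       = refl
φ-suc (suc zero)          zero    = refl
φ-suc (suc zero)          (suc k) = cong (_C 1) (ℕ.0∸n≡0 k)
φ-suc (suc (suc e)) k with k ℕ.≤? 2 ℕ.* suc e
... | yes k≤m = begin
  (2 ℕ.* suc (suc e) ℕ.∸ suc k) C suc (suc e)
    ≡⟨ cong (λ x → (x ℕ.∸ suc k) C suc (suc e)) (ℕ.*-suc 2 (suc e)) ⟩
  (suc m ℕ.∸ k) C suc (suc e)
    ≡⟨ cong (_C suc (suc e)) (ℕ.+-∸-assoc 1 k≤m) ⟩
  suc (m ℕ.∸ k) C suc (suc e)
    ≡⟨ nCk+nC[k+1]≡[n+1]C[k+1] (m ℕ.∸ k) (suc e) ⟨
  (m ℕ.∸ k) C suc e ℕ.+ (m ℕ.∸ k) C suc (suc e)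
    ≡⟨ ℕ.+-comm ((m ℕ.∸ k) C suc e) _ ⟩
  (m ℕ.∸ k) C suc (suc e) ℕ.+ (m ℕ.∸ k) C suc e
    ≡⟨ cong (λ x → (x ℕ.∸ suc (suc k)) C suc (suc e) ℕ.+ (m ℕ.∸ k) C suc e) (ℕ.*-suc 2 (suc e)) ⟨
  (2 ℕ.* suc (suc e) ℕ.∸ suc (suc k)) C suc (suc e) ℕ.+ (m ℕ.∸ k) C suc e ∎
  where m = 2 ℕ.* suc e
... | no k≰m = trans (φ-vanishes (suc (suc e)) (suc k) (s≤s e<k))
  (sym (cong₂ ℕ._+_ (φ-vanishes (suc (suc e)) (suc (suc k)) (s≤s (ℕ.m<n⇒m<1+n e<k)))
                    (φ-vanishes (suc e) k e<k)))
  where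
  e<k : suc e < k
  e<k = ℕ.≤-<-trans (ℕ.m≤m+n (suc e) (suc e ℕ.+ 0)) (ℕ.≰⇒> k≰m)

-- A series g in x alone commutes with the residue in z, so `(Φ d ⋆ g) n` is the residue of the
-- Appell polynomial that e^(zx) g(x) has as its coefficient of x^n/n!, divided by (z (1 - z))^d.
Φ : ℕ → Seq
Φ d k = fromℕ (φ d k)

-- shear f is the umbral substitution z^k ↦ f(k) applied to exp ((2 z - 1) x).
shear : Seq → Seq
shear f = exp⁻ ⋆ S 2ℚ f

-- Differentiating e^((2z-1)x) in x brings down 2z - 1, and shifting `f` by `D` amounts to
-- multiplication by z.
shear-suc : ∀ f n → shear f (suc n) ≡ 2ℚ * shear (D f) n + - shear f n
shear-suc f n = begin
  ((- 1ℚ • exp⁻) ⋆ S 2ℚ f) n + (exp⁻ ⋆ (2ℚ • S 2ℚ (D f))) n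
    ≡⟨ cong₂ _+_ (•-⋆ (- 1ℚ) exp⁻ (S 2ℚ f) n) (⋆-• 2ℚ exp⁻ (S 2ℚ (D f)) n) ⟩
  - 1ℚ * shear f n + 2ℚ * shear (D f) n
    ≡⟨ solve 2 (λ a b → con (- 1ℚ) :* a :+ b := b :+ (:- a)) refl (shear f n) (2ℚ * shear (D f) n) ⟩
  2ℚ * shear (D f) n + - shear f n ∎

-- This is `φ-suc`, the relation z = z^2 + z (1 - z), carried through the linear map `shear`.
shear-Φ-suc : ∀ d n → shear (D (Φ (suc d))) n ≡ shear (D (D (Φ (suc d)))) n + shear (Φ d) n
shear-Φ-suc d n = begin
  shear (D (Φ (suc d))) n
    ≡⟨ ⋆-cong {exp⁻} (λ _ → refl) (S-cong 2ℚ λ k → trans (cong fromℕ (φ-suc d k)) (fromℕ-+ (φ (suc d) (suc (suc k))) (φ d k))) n ⟩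
  shear (D (D (Φ (suc d))) ⊕ Φ d) n
    ≡⟨ ⋆-cong {exp⁻} (λ _ → refl) (S-⊕ 2ℚ (D (D (Φ (suc d)))) (Φ d)) n ⟩
  (exp⁻ ⋆ (S 2ℚ (D (D (Φ (suc d)))) ⊕ S 2ℚ (Φ d))) n
    ≡⟨ ⋆-distribˡ-⊕ exp⁻ (S 2ℚ (D (D (Φ (suc d))))) (S 2ℚ (Φ d)) n ⟩
  shear (D (D (Φ (suc d)))) n + shear (Φ d) n ∎

-- (2 z - 1)^2 = 1 - 4 z (1 - z)
shear-Φ-suc² : ∀ d n → shear (Φ (suc d)) (suc (suc n)) ≡ shear (Φ (suc d)) n + - (fromℕ 4 * shear (Φ d) n)
shear-Φ-suc² d n = begin
  shear f (suc (suc n))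
    ≡⟨ shear-suc f (suc n) ⟩
  2ℚ * shear (D f) (suc n) + - shear f (suc n)
    ≡⟨ cong₂ (λ a b → 2ℚ * a + - b) (shear-suc (D f) n) (shear-suc f n) ⟩
  2ℚ * (2ℚ * shear (D (D f)) n + - shear (D f) n) + - (2ℚ * shear (D f) n + - shear f n)
    ≡⟨ cong (λ a → 2ℚ * (2ℚ * shear (D (D f)) n + - a) + - (2ℚ * a + - shear f n)) (shear-Φ-suc d n) ⟩
  2ℚ * (2ℚ * shear (D (D f)) n + - (shear (D (D f)) n + shear (Φ d) n)) + - (2ℚ * (shear (D (D f)) n + shear (Φ d) n) + - shear f n)
    ≡⟨ solve 3 (λ a b c → con 2ℚ :* (con 2ℚ :* a :+ (:- (a :+ b))) :+ (:- (con 2ℚ :* (a :+ b) :+ (:- c))) := c :+ (:- (con (fromℕ 4) :* b)))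
         refl (shear (D (D f)) n) (shear (Φ d) n) (shear f n) ⟩
  shear f n + - (fromℕ 4 * shear (Φ d) n) ∎
  where f = Φ (suc d)

shear-Φ-0 : ∀ n → shear (Φ 0) n ≡ 0ℚ
shear-Φ-0 n = begin
  (exp⁻ ⋆ S 2ℚ 𝟘) n       ≡⟨ ⋆-cong {exp⁻} (λ _ → refl) (S-cong 2ℚ {𝟘} {κ 0ℚ} λ { zero → refl ; (suc k) → refl }) n ⟩
  (exp⁻ ⋆ S 2ℚ (κ 0ℚ)) n  ≡⟨ ⋆-cong {exp⁻} (λ _ → refl) (S-κ 2ℚ 0ℚ) n ⟩
  (exp⁻ ⋆ κ 0ℚ) n         ≡⟨ ⋆-comm exp⁻ (κ 0ℚ) n ⟩
  (κ 0ℚ ⋆ exp⁻) n         ≡⟨ κ-⋆ 0ℚ exp⁻ n ⟩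
  0ℚ * exp⁻ n             ≡⟨ ℚ.*-zeroˡ (exp⁻ n) ⟩
  0ℚ                      ∎

-4^_ : ℕ → ℚ
-4^ e = sign e * fromℕ (4 ℕ.^ e)

-4^-suc : ∀ e → -4^ (suc e) ≡ - (fromℕ 4 * -4^ e)
-4^-suc e = begin
  sign (suc e) * fromℕ (4 ℕ.* 4 ℕ.^ e)       ≡⟨ cong₂ _*_ (sign-suc e) (fromℕ-* 4 (4 ℕ.^ e)) ⟩
  - sign e * (fromℕ 4 * fromℕ (4 ℕ.^ e))     ≡⟨ solve 2 (λ s a → (:- s) :* (con (fromℕ 4) :* a) := :- (con (fromℕ 4) :* (s :* a))) refl (sign e) (fromℕ (4 ℕ.^ e)) ⟩
  - (fromℕ 4 * -4^ e)                        ∎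

-- Raising `p` by one multiplies by 1 - 4 z (1 - z), and the factor z (1 - z) lowers the order of
-- the pole by one; with (-4)^e split off, this is Pascal's rule. The leading minus sign comes from
-- 2z - 1 in place of 1 - 2z.
shear-Φ : ∀ e p → shear (Φ (suc e)) (suc (2 ℕ.* p)) ≡ - (-4^ e * fromℕ (p C e))
shear-Φ zero    zero    = refl
-- Here (2z - 1) dz / w^(e+2) with w = z (1 - z) is an exact differential and has no residue;
-- numerically, `φ` at 0 is twice `φ` at 1.
shear-Φ (suc e) zero    = begin
  shear (Φ (suc (suc e))) 1
    ≡⟨ shear-suc (Φ (suc (suc e))) 0 ⟩
  2ℚ * (1ℚ * fromℕ (φ (suc (suc e)) 1)) + - (1ℚ * fromℕ (φ (suc (suc e)) 0))
    ≡⟨ cong (λ a → 2ℚ * (1ℚ * fromℕ (φ (suc (suc e)) 1)) + - (1ℚ * a)) (trans (cong fromℕ (central-binomial e)) (fromℕ-* 2 (φ (suc (suc e)) 1))) ⟩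
  2ℚ * (1ℚ * fromℕ (φ (suc (suc e)) 1)) + - (1ℚ * (2ℚ * fromℕ (φ (suc (suc e)) 1)))
    ≡⟨ solve 1 (λ a → con 2ℚ :* (con 1ℚ :* a) :+ (:- (con 1ℚ :* (con 2ℚ :* a))) := con 0ℚ) refl (fromℕ (φ (suc (suc e)) 1)) ⟩
  0ℚ
    ≡⟨ solve 1 (λ a → con 0ℚ := :- (a :* con 0ℚ)) refl (-4^ suc e) ⟩
  - (-4^ suc e * fromℕ 0)
    ≡⟨ cong (λ c → - (-4^ suc e * fromℕ c)) (k>n⇒nCk≡0 {0} {suc e} (s≤s z≤n)) ⟨
  - (-4^ suc e * fromℕ (0 C suc e)) ∎
shear-Φ e (suc p) = trans (cong (shear (Φ (suc e)) ∘ suc) (ℕ.*-suc 2 p))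
                          (trans (shear-Φ-suc² e (suc (2 ℕ.* p))) (step e))
  where
  step : ∀ e → shear (Φ (suc e)) (suc (2 ℕ.* p)) + - (fromℕ 4 * shear (Φ e) (suc (2 ℕ.* p))) ≡ - (-4^ e * fromℕ (suc p C e))
  -- A simple pole is removed altogether by z (1 - z), so the term of `Φ 0` drops out and the value
  -- does not depend on `p`.
  step zero    = begin
    shear (Φ 1) (suc (2 ℕ.* p)) + - (fromℕ 4 * shear (Φ 0) (suc (2 ℕ.* p)))
      ≡⟨ cong₂ (λ a b → a + - (fromℕ 4 * b)) (shear-Φ 0 p) (shear-Φ-0 (suc (2 ℕ.* p))) ⟩
    - (-4^ 0 * fromℕ (p C 0)) + - (fromℕ 4 * 0ℚ)
      ≡⟨ ℚ.+-identityʳ (- (-4^ 0 * fromℕ (p C 0))) ⟩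
    - (-4^ 0 * fromℕ (p C 0))
      ≡⟨ cong (λ c → - (-4^ 0 * fromℕ c)) (trans (nC0≡1 p) (sym (nC0≡1 (suc p)))) ⟩
    - (-4^ 0 * fromℕ (suc p C 0)) ∎
  step (suc e) = begin
    shear (Φ (suc (suc e))) (suc (2 ℕ.* p)) + - (fromℕ 4 * shear (Φ (suc e)) (suc (2 ℕ.* p)))
      ≡⟨ cong₂ (λ a b → a + - (fromℕ 4 * b)) (shear-Φ (suc e) p) (shear-Φ e p) ⟩
    - (-4^ suc e * fromℕ (p C suc e)) + - (fromℕ 4 * - (-4^ e * fromℕ (p C e)))
      ≡⟨ cong (λ s → - (s * fromℕ (p C suc e)) + - (fromℕ 4 * - (-4^ e * fromℕ (p C e)))) (-4^-suc e) ⟩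
    - (- (fromℕ 4 * -4^ e) * fromℕ (p C suc e)) + - (fromℕ 4 * - (-4^ e * fromℕ (p C e)))
      ≡⟨ solve 3 (λ s a b → (:- ((:- (con (fromℕ 4) :* s)) :* b)) :+ (:- (con (fromℕ 4) :* (:- (s :* a))))
                   := :- ((:- (con (fromℕ 4) :* s)) :* (a :+ b))) refl (-4^ e) (fromℕ (p C e)) (fromℕ (p C suc e)) ⟩
    - (- (fromℕ 4 * -4^ e) * (fromℕ (p C e) + fromℕ (p C suc e)))
      ≡⟨ cong₂ (λ s c → - (s * c)) (-4^-suc e) (fromℕ-+ (p C e) (p C suc e)) ⟨
    - (-4^ suc e * fromℕ (p C e ℕ.+ p C suc e))
      ≡⟨ cong (λ c → - (-4^ suc e * fromℕ c)) (nCk+nC[k+1]≡[n+1]C[k+1] p e) ⟩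
    - (-4^ suc e * fromℕ (suc p C suc e)) ∎

-- The two sides of the identity

eulerTerm : ℕ → ℕ → ℕ → ℚ
eulerTerm d n l = fromℕ ((n ℕ.∸ l) C d) * fromℕ ((2 ℕ.* n) C (2 ℕ.* l)) * E2 l

-- With n = p + 1 and d = e + 1, both sides pass through 2 (n-l) C(2n,2l) C(n-l-1,d-1): one
-- absorption turns 2n C(2n-1,2l) into (2n-2l) C(2n,2l), another turns (n-l) C(n-l-1,d-1) into d
-- C(n-l,d).
absorption : ∀ e p l → l ≤ p →
  2 ℕ.* suc p ℕ.* (suc (2 ℕ.* p) C (2 ℕ.* l)) ℕ.* ((p ℕ.∸ l) C e)
  ≡ 2 ℕ.* suc e ℕ.* ((suc p ℕ.∸ l) C suc e) ℕ.* ((2 ℕ.* suc p) C (2 ℕ.* l))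
absorption e p l l≤p = begin
  2 ℕ.* suc p ℕ.* (m C k) ℕ.* (q C e)
    ≡⟨ cong (λ x → x ℕ.* (m C k) ℕ.* (q C e)) (ℕ.*-suc 2 p) ⟩
  suc m ℕ.* (m C k) ℕ.* (q C e)
    ≡⟨ cong (ℕ._* (q C e)) ([1+n∸k]*[1+n]Ck m k k≤m) ⟨
  suc (m ℕ.∸ k) ℕ.* (suc m C k) ℕ.* (q C e)
    ≡⟨ cong (λ x → x ℕ.* (suc m C k) ℕ.* (q C e)) 1+m∸k ⟩
  2 ℕ.* suc q ℕ.* (suc m C k) ℕ.* (q C e)
    ≡⟨ N.solve 3 (λ x y z → N.con 2 N.:* x N.:* y N.:* z N.:= N.con 2 N.:* (x N.:* z) N.:* y) refl (suc q) (suc m C k) (q C e) ⟩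
  2 ℕ.* (suc q ℕ.* (q C e)) ℕ.* (suc m C k)
    ≡⟨ cong (λ x → 2 ℕ.* x ℕ.* (suc m C k)) ([1+k]*[1+n]C[1+k] q e) ⟨
  2 ℕ.* (suc e ℕ.* (suc q C suc e)) ℕ.* (suc m C k)
    ≡⟨ cong (ℕ._* (suc m C k)) (ℕ.*-assoc 2 (suc e) (suc q C suc e)) ⟨
  2 ℕ.* suc e ℕ.* (suc q C suc e) ℕ.* (suc m C k)
    ≡⟨ cong₂ (λ x y → 2 ℕ.* suc e ℕ.* (x C suc e) ℕ.* (y C k)) (ℕ.+-∸-assoc 1 l≤p) (ℕ.*-suc 2 p) ⟨
  2 ℕ.* suc e ℕ.* ((suc p ℕ.∸ l) C suc e) ℕ.* ((2 ℕ.* suc p) C k) ∎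
  where
  module N = ℕSolver.+-*-Solver
  m = suc (2 ℕ.* p)
  k = 2 ℕ.* l
  q = p ℕ.∸ l
  2l≤2p : k ≤ 2 ℕ.* p
  2l≤2p = ℕ.*-monoʳ-≤ 2 l≤p
  k≤m : k ≤ m
  k≤m = ℕ.m≤n⇒m≤1+n 2l≤2p
  1+m∸k : suc (m ℕ.∸ k) ≡ 2 ℕ.* suc q
  1+m∸k = begin
    suc (m ℕ.∸ k)             ≡⟨ cong suc (ℕ.+-∸-assoc 1 2l≤2p) ⟩
    2 ℕ.+ (2 ℕ.* p ℕ.∸ k)     ≡⟨ cong (2 ℕ.+_) (ℕ.*-distribˡ-∸ 2 p l) ⟨
    2 ℕ.+ 2 ℕ.* q             ≡⟨ ℕ.*-suc 2 q ⟨
    2 ℕ.* suc q               ∎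

-- As sech is even and the index is odd, only odd coefficients of `shear` enter, which `shear-Φ`
-- evaluates. The prefactor 2n is the one that `X` contributes at index 2n; `absorption` consumes
-- it.
sech-shear-Φ : ∀ e p → fromℕ (2 ℕ.* suc p) * (sech ⋆ shear (Φ (suc e))) (suc (2 ℕ.* p))
             ≡ - (2ℚ * fromℕ (suc e) * -4^ e * sumTo p (eulerTerm (suc e) (suc p)))
sech-shear-Φ e p = begin
  fromℕ (2 ℕ.* suc p) * (sech ⋆ Ψ) m
    ≡⟨ cong (fromℕ (2 ℕ.* suc p) *_) (⋆-binomial m sech Ψ) ⟩
  fromℕ (2 ℕ.* suc p) * sumTo m (λ k → fromℕ (m C k) * (sech k * Ψ (m ℕ.∸ k)))
    ≡⟨ cong (fromℕ (2 ℕ.* suc p) *_) (sumTo-evens′ p _ λ k _ →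
         *-zero-middle (fromℕ (m C suc (2 ℕ.* k))) (Ψ (m ℕ.∸ suc (2 ℕ.* k))) (spread-even E2 k)) ⟩
  fromℕ (2 ℕ.* suc p) * sumTo p (λ l → fromℕ (m C (2 ℕ.* l)) * (sech (2 ℕ.* l) * Ψ (m ℕ.∸ 2 ℕ.* l)))
    ≡⟨ sumTo-*ˡ p (fromℕ (2 ℕ.* suc p)) (λ l → fromℕ (m C (2 ℕ.* l)) * (sech (2 ℕ.* l) * Ψ (m ℕ.∸ 2 ℕ.* l))) ⟨
  sumTo p (λ l → fromℕ (2 ℕ.* suc p) * (fromℕ (m C (2 ℕ.* l)) * (sech (2 ℕ.* l) * Ψ (m ℕ.∸ 2 ℕ.* l))))
    ≡⟨ sumTo-cong p term ⟩
  sumTo p (λ l → - (2ℚ * fromℕ (suc e) * -4^ e) * eulerTerm (suc e) (suc p) l)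
    ≡⟨ sumTo-*ˡ p (- (2ℚ * fromℕ (suc e) * -4^ e)) (eulerTerm (suc e) (suc p)) ⟩
  - (2ℚ * fromℕ (suc e) * -4^ e) * sumTo p (eulerTerm (suc e) (suc p))
    ≡⟨ ℚ.neg-distribˡ-* (2ℚ * fromℕ (suc e) * -4^ e) (sumTo p (eulerTerm (suc e) (suc p))) ⟨
  - (2ℚ * fromℕ (suc e) * -4^ e * sumTo p (eulerTerm (suc e) (suc p))) ∎
  where
  Ψ = shear (Φ (suc e))
  m = suc (2 ℕ.* p)
  fromℕ-*³ : ∀ a b c → fromℕ (a ℕ.* b ℕ.* c) ≡ fromℕ a * fromℕ b * fromℕ c
  fromℕ-*³ a b c = trans (fromℕ-* (a ℕ.* b) c) (cong (_* fromℕ c) (fromℕ-* a b))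
  term : ∀ l → l ≤ p → fromℕ (2 ℕ.* suc p) * (fromℕ (m C (2 ℕ.* l)) * (sech (2 ℕ.* l) * Ψ (m ℕ.∸ 2 ℕ.* l)))
       ≡ - (2ℚ * fromℕ (suc e) * -4^ e) * eulerTerm (suc e) (suc p) l
  term l l≤p = begin
    fromℕ (2 ℕ.* suc p) * (fromℕ (m C (2 ℕ.* l)) * (sech (2 ℕ.* l) * Ψ (m ℕ.∸ 2 ℕ.* l)))
      ≡⟨ cong₂ (λ s t → fromℕ (2 ℕ.* suc p) * (fromℕ (m C (2 ℕ.* l)) * (s * t))) (spread-2* E2 l) Ψ-l ⟩
    fromℕ (2 ℕ.* suc p) * (fromℕ (m C (2 ℕ.* l)) * (E2 l * - (-4^ e * fromℕ (q C e))))
      ≡⟨ solve 5 (λ a b x s c → a :* (b :* (x :* (:- (s :* c)))) := :- (s :* (a :* b :* c) :* x)) refl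
           (fromℕ (2 ℕ.* suc p)) (fromℕ (m C (2 ℕ.* l))) (E2 l) (-4^ e) (fromℕ (q C e)) ⟩
    - (-4^ e * (fromℕ (2 ℕ.* suc p) * fromℕ (m C (2 ℕ.* l)) * fromℕ (q C e)) * E2 l)
      ≡⟨ cong (λ x → - (-4^ e * x * E2 l)) (fromℕ-*³ (2 ℕ.* suc p) (m C (2 ℕ.* l)) (q C e)) ⟨
    - (-4^ e * fromℕ (2 ℕ.* suc p ℕ.* (m C (2 ℕ.* l)) ℕ.* (q C e)) * E2 l)
      ≡⟨ cong (λ x → - (-4^ e * fromℕ x * E2 l)) (absorption e p l l≤p) ⟩
    - (-4^ e * fromℕ (2 ℕ.* suc e ℕ.* ((suc p ℕ.∸ l) C suc e) ℕ.* ((2 ℕ.* suc p) C (2 ℕ.* l))) * E2 l)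
      ≡⟨ cong (λ x → - (-4^ e * x * E2 l)) (trans (fromℕ-*³ (2 ℕ.* suc e) ((suc p ℕ.∸ l) C suc e) ((2 ℕ.* suc p) C (2 ℕ.* l)))
           (cong (λ x → x * fromℕ ((suc p ℕ.∸ l) C suc e) * fromℕ ((2 ℕ.* suc p) C (2 ℕ.* l))) (fromℕ-* 2 (suc e)))) ⟩
    - (-4^ e * (2ℚ * fromℕ (suc e) * fromℕ ((suc p ℕ.∸ l) C suc e) * fromℕ ((2 ℕ.* suc p) C (2 ℕ.* l))) * E2 l)
      ≡⟨ solve 6 (λ s a b c d x → :- (s :* (a :* b :* c :* d) :* x) := (:- (a :* b :* s)) :* (c :* d :* x)) refl
           (-4^ e) 2ℚ (fromℕ (suc e)) (fromℕ ((suc p ℕ.∸ l) C suc e)) (fromℕ ((2 ℕ.* suc p) C (2 ℕ.* l))) (E2 l) ⟩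
    - (2ℚ * fromℕ (suc e) * -4^ e) * eulerTerm (suc e) (suc p) l ∎
    where
    q = p ℕ.∸ l
    Ψ-l : Ψ (m ℕ.∸ 2 ℕ.* l) ≡ - (-4^ e * fromℕ (q C e))
    Ψ-l = begin
      Ψ (m ℕ.∸ 2 ℕ.* l)             ≡⟨ cong Ψ (ℕ.+-∸-assoc 1 (ℕ.*-monoʳ-≤ 2 l≤p)) ⟩
      Ψ (suc (2 ℕ.* p ℕ.∸ 2 ℕ.* l)) ≡⟨ cong (Ψ ∘ suc) (ℕ.*-distribˡ-∸ 2 p l) ⟨
      Ψ (suc (2 ℕ.* q))             ≡⟨ shear-Φ e q ⟩
      - (-4^ e * fromℕ (q C e))     ∎

Φ-⋆-G : ∀ e p → fromℕ (4 ℕ.^ suc p) * (Φ (suc e) ⋆ G) (2 ℕ.* suc p)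
      ≡ 2ℚ * fromℕ (suc e) * -4^ e * sumTo p (eulerTerm (suc e) (suc p))
Φ-⋆-G e p = begin
  fromℕ (4 ℕ.^ suc p) * (Φ′ ⋆ G) n
    ≡⟨ cong (λ x → fromℕ x * (Φ′ ⋆ G) n) (ℕ.^-*-assoc 2 2 (suc p)) ⟩
  fromℕ (2 ℕ.^ n) * (Φ′ ⋆ G) n
    ≡⟨ S-coefficient 2 (Φ′ ⋆ G) n ⟨
  S 2ℚ (Φ′ ⋆ G) n
    ≡⟨ S-⋆ 2ℚ Φ′ G n ⟩
  (S 2ℚ Φ′ ⋆ S 2ℚ G) n
    ≡⟨ ⋆-cong {S 2ℚ Φ′} (λ _ → refl) S-2-G n ⟩
  (S 2ℚ Φ′ ⋆ ⊖ (X ⋆ (sech ⋆ exp⁻))) n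
    -- The factor e^(-x) contributed by `S-2-G` moves next to `S 2ℚ Φ′`, where the two form
    -- `shear Φ′`.
    ≡⟨ N.solve 4 (λ f x h e⁻ → f N.:* (N.:- (x N.:* (h N.:* e⁻))) N.:= N.:- (x N.:* (h N.:* (e⁻ N.:* f)))) (λ _ → refl) (S 2ℚ Φ′) X sech exp⁻ n ⟩
  - (X ⋆ (sech ⋆ shear Φ′)) n
    ≡⟨ cong (λ k → - (X ⋆ (sech ⋆ shear Φ′)) k) (ℕ.*-suc 2 p) ⟩
  - (X ⋆ (sech ⋆ shear Φ′)) (suc (suc (2 ℕ.* p)))
    ≡⟨ cong -_ (X-⋆ (sech ⋆ shear Φ′) (suc (2 ℕ.* p))) ⟩
  - (fromℕ (suc (suc (2 ℕ.* p))) * (sech ⋆ shear Φ′) (suc (2 ℕ.* p)))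
    ≡⟨ cong (λ k → - (fromℕ k * (sech ⋆ shear Φ′) (suc (2 ℕ.* p)))) (ℕ.*-suc 2 p) ⟨
  - (fromℕ n * (sech ⋆ shear Φ′) (suc (2 ℕ.* p)))
    ≡⟨ cong -_ (sech-shear-Φ e p) ⟩
  - - T
    ≡⟨ solve 1 (λ t → :- (:- t) := t) refl T ⟩
  T ∎
  where
  module N = Solver
  n = 2 ℕ.* suc p
  Φ′ = Φ (suc e)
  T = 2ℚ * fromℕ (suc e) * -4^ e * sumTo p (eulerTerm (suc e) (suc p))

-- The correction x/2 contributes half of 2n times the residue of z^(2n-1). This is nonzero only if
-- the order d of the pole exceeds 2n - 1, which separates the cases of the theorem.
Φ-⋆-G₀ : ∀ d p → (Φ d ⋆ G₀) (2 ℕ.* suc p) ≡ (Φ d ⋆ G) (2 ℕ.* suc p) + fromℕ (suc p) * Φ d (suc (2 ℕ.* p))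
Φ-⋆-G₀ d p = begin
  (Φ d ⋆ G₀) n
    ≡⟨ N.solve 3 (λ f g x → f N.:* (g N.:+ N.con ½ N.:* x) N.:= f N.:* g N.:+ N.con ½ N.:* (x N.:* f)) (λ _ → refl) (Φ d) G X n ⟩
  (Φ d ⋆ G) n + (κ ½ ⋆ (X ⋆ Φ d)) n
    ≡⟨ cong ((Φ d ⋆ G) n +_) (begin
         (κ ½ ⋆ (X ⋆ Φ d)) n
           ≡⟨ κ-⋆ ½ (X ⋆ Φ d) n ⟩
         ½ * (X ⋆ Φ d) n
           ≡⟨ cong (λ k → ½ * (X ⋆ Φ d) k) (ℕ.*-suc 2 p) ⟩
         ½ * (X ⋆ Φ d) (suc (suc (2 ℕ.* p)))
           ≡⟨ cong (½ *_) (X-⋆ (Φ d) (suc (2 ℕ.* p))) ⟩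
         ½ * (fromℕ (suc (suc (2 ℕ.* p))) * Φ d (suc (2 ℕ.* p)))
           ≡⟨ cong (λ a → ½ * (a * Φ d (suc (2 ℕ.* p)))) (trans (cong fromℕ (sym (ℕ.*-suc 2 p))) (fromℕ-* 2 (suc p))) ⟩
         ½ * (2ℚ * fromℕ (suc p) * Φ d (suc (2 ℕ.* p)))
           ≡⟨ solve 2 (λ a b → con ½ :* (con 2ℚ :* a :* b) := a :* b) refl (fromℕ (suc p)) (Φ d (suc (2 ℕ.* p))) ⟩
         fromℕ (suc p) * Φ d (suc (2 ℕ.* p)) ∎) ⟩
  (Φ d ⋆ G) n + fromℕ (suc p) * Φ d (suc (2 ℕ.* p)) ∎
  where
  module N = Solver
  n = 2 ℕ.* suc p

2n∸odd : ∀ {n k} → k < n → 2 ℕ.* n ℕ.∸ suc (2 ℕ.* k) ≡ suc (2 ℕ.* (n ℕ.∸ suc k))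
2n∸odd {n} {k} k<n = begin
  2 ℕ.* n ℕ.∸ suc (2 ℕ.* k)
    ≡⟨ cong (λ x → 2 ℕ.* x ℕ.∸ suc (2 ℕ.* k)) (ℕ.m+[n∸m]≡n k<n) ⟨
  2 ℕ.* (suc k ℕ.+ r) ℕ.∸ suc (2 ℕ.* k)
    ≡⟨ cong (ℕ._∸ suc (2 ℕ.* k)) (N.solve 2 (λ k r → N.con 2 N.:* (N.con 1 N.:+ k N.:+ r)
         N.:= N.con 1 N.:+ N.con 2 N.:* k N.:+ (N.con 1 N.:+ N.con 2 N.:* r)) refl k r) ⟩
  suc (2 ℕ.* k) ℕ.+ suc (2 ℕ.* r) ℕ.∸ suc (2 ℕ.* k)
    ≡⟨ ℕ.m+n∸m≡n (suc (2 ℕ.* k)) (suc (2 ℕ.* r)) ⟩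
  suc (2 ℕ.* r) ∎
  where
  module N = ℕSolver.+-*-Solver
  r = n ℕ.∸ suc k

half<⇒<2* : ∀ e j → ℕ.⌊ e /2⌋ < j → e < 2 ℕ.* j
half<⇒<2* e j h<j = ℕ.≰⇒> λ 2j≤e → ℕ.<⇒≱ h<j
  (subst (_≤ ℕ.⌊ e /2⌋)
    (trans (cong (λ x → ℕ.⌊ j ℕ.+ x /2⌋) (ℕ.+-identityʳ j)) (sym (ℕ.n≡⌊n+n/2⌋ j)))
    (ℕ.⌊n/2⌋-mono 2j≤e))

lhsTerm : ℕ → ℕ → ℕ → ℚ
lhsTerm d n j = fromℕ ((2 ℕ.* n) C (2 ℕ.* j)) * (Φ d (2 ℕ.* j) * G₀ (2 ℕ.* n ℕ.∸ 2 ℕ.* j))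

-- An odd index of `Φ` is paired with an odd index of `G₀`, where the even series `G₀` vanishes.
Φ-⋆-G₀-sum : ∀ d n → (Φ d ⋆ G₀) (2 ℕ.* n) ≡ sumTo n (lhsTerm d n)
Φ-⋆-G₀-sum d n = trans (⋆-binomial (2 ℕ.* n) (Φ d) G₀) (sumTo-evens n _ λ k k<n → begin
  fromℕ ((2 ℕ.* n) C suc (2 ℕ.* k)) * (Φ d (suc (2 ℕ.* k)) * G₀ (2 ℕ.* n ℕ.∸ suc (2 ℕ.* k)))
    ≡⟨ cong (λ x → fromℕ ((2 ℕ.* n) C suc (2 ℕ.* k)) * (Φ d (suc (2 ℕ.* k)) * x))
         (trans (cong G₀ (2n∸odd k<n)) (G₀-even (n ℕ.∸ suc k))) ⟩
  fromℕ ((2 ℕ.* n) C suc (2 ℕ.* k)) * (Φ d (suc (2 ℕ.* k)) * 0ℚ)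
    ≡⟨ solve 2 (λ a b → a :* (b :* con 0ℚ) := con 0ℚ) refl (fromℕ ((2 ℕ.* n) C suc (2 ℕ.* k))) (Φ d (suc (2 ℕ.* k))) ⟩
  0ℚ ∎)

lhs≡Φ-⋆-G₀ : ∀ e n → lhs (suc e) n ≡ inv (2 ℕ.^ (2 ℕ.* suc e ℕ.∸ 1) ℕ.* suc e) * (Φ (suc e) ⋆ G₀) (2 ℕ.* n)
lhs≡Φ-⋆-G₀ e n = begin
  lhs (suc e) n                ≡⟨ sumTo-cong h term ⟩
  sumTo h (λ j → c * t j)      ≡⟨ sumTo-*ˡ h c t ⟩
  c * sumTo h t                ≡⟨ cong (c *_) range ⟩
  c * sumTo n t                ≡⟨ cong (c *_) (Φ-⋆-G₀-sum (suc e) n) ⟨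
  c * (Φ (suc e) ⋆ G₀) (2 ℕ.* n) ∎
  where
  h = ℕ.⌊ e /2⌋
  c = inv (2 ℕ.^ (2 ℕ.* suc e ℕ.∸ 1) ℕ.* suc e)
  t = lhsTerm (suc e) n
  t-vanishes-h : ∀ j → h < j → t j ≡ 0ℚ
  t-vanishes-h j h<j = trans
    (cong (λ x → fromℕ ((2 ℕ.* n) C (2 ℕ.* j)) * (fromℕ x * G₀ (2 ℕ.* n ℕ.∸ 2 ℕ.* j))) (φ-vanishes e (2 ℕ.* j) (half<⇒<2* e j h<j)))
    (solve 2 (λ a b → a :* (con 0ℚ :* b) := con 0ℚ) refl (fromℕ ((2 ℕ.* n) C (2 ℕ.* j))) (G₀ (2 ℕ.* n ℕ.∸ 2 ℕ.* j)))
  t-vanishes-n : ∀ j → n < j → t j ≡ 0ℚ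
  t-vanishes-n j n<j = trans
    (cong (λ x → fromℕ x * (Φ (suc e) (2 ℕ.* j) * G₀ (2 ℕ.* n ℕ.∸ 2 ℕ.* j))) (k>n⇒nCk≡0 (ℕ.*-monoʳ-< 2 n<j)))
    (ℚ.*-zeroˡ (Φ (suc e) (2 ℕ.* j) * G₀ (2 ℕ.* n ℕ.∸ 2 ℕ.* j)))
  -- Either bound may be the larger one. Terms beyond `h` vanish because z^(2j) cancels the pole,
  -- terms beyond `n` because C(2n,2j) is 0.
  range : sumTo h t ≡ sumTo n t
  range with ℕ.≤-total h n
  ... | inj₁ h≤n = sym (sumTo-extend t h≤n t-vanishes-h)
  ... | inj₂ n≤h = sumTo-extend t n≤h t-vanishes-n
  term : ∀ j → j ≤ h →
    fromℕ (2 ℕ.^ (2 ℕ.* n ℕ.∸ 2 ℕ.* j) ℕ.∸ 1) * B (2 ℕ.* n ℕ.∸ 2 ℕ.* j) * c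
      * fromℕ ((2 ℕ.* suc e ℕ.∸ 2 ℕ.* j ℕ.∸ 2) C e) * fromℕ ((2 ℕ.* n) C (2 ℕ.* j))
    ≡ c * t j
  term j j≤h = begin
    fromℕ (2 ℕ.^ m ℕ.∸ 1) * B m * c * fromℕ ((2 ℕ.* suc e ℕ.∸ 2 ℕ.* j ℕ.∸ 2) C e) * b
      ≡⟨ cong₂ (λ x y → x * c * fromℕ y * b) g-term φ-term ⟩
    G₀ m * c * Φ (suc e) (2 ℕ.* j) * b
      ≡⟨ solve 4 (λ g c f b → g :* c :* f :* b := c :* (b :* (f :* g))) refl (G₀ m) c (Φ (suc e) (2 ℕ.* j)) b ⟩
    c * t j ∎
    where
    m = 2 ℕ.* n ℕ.∸ 2 ℕ.* j
    b = fromℕ ((2 ℕ.* n) C (2 ℕ.* j))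
    -- For `j > n` truncation makes `m` zero, which is still twice `n ∸ j`, so `G₀-2*` applies to
    -- every `j`.
    g-term : fromℕ (2 ℕ.^ m ℕ.∸ 1) * B m ≡ G₀ m
    g-term = subst (λ m → fromℕ (2 ℕ.^ m ℕ.∸ 1) * B m ≡ G₀ m) (ℕ.*-distribˡ-∸ 2 n j) (sym (G₀-2* (n ℕ.∸ j)))
    2j≤e : 2 ℕ.* j ≤ e
    2j≤e = ℕ.≮⇒≥ λ e<2j → ℕ.<-irrefl refl (ℕ.<-≤-trans e<2j (ℕ.≤-trans (ℕ.*-monoʳ-≤ 2 j≤h) double-half))
      where
      double-half : 2 ℕ.* h ≤ e
      double-half = subst (2 ℕ.* h ≤_) (ℕ.⌊n/2⌋+⌈n/2⌉≡n e)
        (ℕ.+-monoʳ-≤ h (subst (_≤ ℕ.⌈ e /2⌉) (sym (ℕ.+-identityʳ h)) (ℕ.⌊n/2⌋≤⌈n/2⌉ e)))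
    φ-term : (2 ℕ.* suc e ℕ.∸ 2 ℕ.* j ℕ.∸ 2) C e ≡ φ (suc e) (2 ℕ.* j)
    φ-term = begin
      (2 ℕ.* suc e ℕ.∸ 2 ℕ.* j ℕ.∸ 2) C e
        ≡⟨ cong (_C e) (trans (ℕ.∸-+-assoc (2 ℕ.* suc e) (2 ℕ.* j) 2) (cong₂ ℕ._∸_ (ℕ.*-suc 2 e) (ℕ.+-comm (2 ℕ.* j) 2))) ⟩
      (2 ℕ.* e ℕ.∸ 2 ℕ.* j) C e
        ≡⟨ φ-binomial e (2 ℕ.* j) 2j≤e ⟨
      φ (suc e) (2 ℕ.* j) ∎

Φ-⋆-G-inv : ∀ e p → (Φ (suc e) ⋆ G) (2 ℕ.* suc p)
      ≡ inv (4 ℕ.^ suc p) * (2ℚ * fromℕ (suc e) * -4^ e * sumTo p (eulerTerm (suc e) (suc p)))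
Φ-⋆-G-inv e p = *-cancelˡ-fromℕ q {{q≢0}} (begin
  fromℕ q * (Φ (suc e) ⋆ G) (2 ℕ.* suc p)  ≡⟨ Φ-⋆-G e p ⟩
  T                                        ≡⟨ ℚ.*-identityˡ T ⟨
  1ℚ * T                                   ≡⟨ cong (_* T) (inv-* q {{q≢0}}) ⟨
  inv q * fromℕ q * T                      ≡⟨ solve 3 (λ i q t → i :* q :* t := q :* (i :* t)) refl (inv q) (fromℕ q) T ⟩
  fromℕ q * (inv q * T)                    ∎)
  where
  q = 4 ℕ.^ suc p
  q≢0 = ℕ.m^n≢0 4 (suc p)
  T = 2ℚ * fromℕ (suc e) * -4^ e * sumTo p (eulerTerm (suc e) (suc p))

eulerTerm-vanishes : ∀ d n l → n ℕ.∸ l < d → eulerTerm d n l ≡ 0ℚ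
eulerTerm-vanishes d n l n∸l<d = trans
  (cong (λ x → fromℕ x * fromℕ ((2 ℕ.* n) C (2 ℕ.* l)) * E2 l) (k>n⇒nCk≡0 n∸l<d))
  (solve 2 (λ a b → con 0ℚ :* a :* b := con 0ℚ) refl (fromℕ ((2 ℕ.* n) C (2 ℕ.* l))) (E2 l))

-- The three ranges of d

lhs≡rhs : ∀ e p → e ≤ p → lhs (suc e) (suc p) ≡ rhs (suc e) (suc p)
lhs≡rhs e p e≤p = begin
  lhs (suc e) (suc p)
    ≡⟨ lhs≡Φ-⋆-G₀ e (suc p) ⟩
  inv N * (Φ (suc e) ⋆ G₀) (2 ℕ.* suc p)
    ≡⟨ cong (inv N *_) (Φ-⋆-G₀ (suc e) p) ⟩
  inv N * ((Φ (suc e) ⋆ G) (2 ℕ.* suc p) + fromℕ (suc p) * fromℕ (φ (suc e) (suc (2 ℕ.* p))))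
    ≡⟨ cong₂ (λ x y → inv N * (x + fromℕ (suc p) * fromℕ y)) (Φ-⋆-G-inv e p)
         (φ-vanishes e (suc (2 ℕ.* p)) (s≤s (ℕ.≤-trans e≤p (ℕ.m≤m+n p (p ℕ.+ 0))))) ⟩
  inv N * (i * (2ℚ * fromℕ (suc e) * (sign e * f) * T) + fromℕ (suc p) * 0ℚ)
    ≡⟨ solve 7 (λ iN i d s f t n → iN :* (i :* (con 2ℚ :* d :* (s :* f) :* t) :+ n :* con 0ℚ)
                 := (iN :* (con 2ℚ :* f :* d)) :* (s :* i :* t)) refl (inv N) i (fromℕ (suc e)) (sign e) f T (fromℕ (suc p)) ⟩
  inv N * (2ℚ * f * fromℕ (suc e)) * (sign e * i * T)
    -- The denominator 2^(2d-1) d is exactly 2 · 4^(d-1) d: the 2d left by `absorption` times the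
    -- power of four from the residue.
    ≡⟨ cong (_* (sign e * i * T)) (trans (cong (inv N *_) (sym fromℕ-N)) (inv-* N {{N≢0}})) ⟩
  1ℚ * (sign e * i * T)
    ≡⟨ ℚ.*-identityˡ (sign e * i * T) ⟩
  sign e * i * T
    -- The signs at d - 1 and d + 1 agree by periodicity. The sum up to n - 1 shortens to n - d
    -- because C(n-l,d) vanishes once n - l is below d.
    ≡⟨ cong₂ (λ s t → s * i * t) (cong sign (ℕ.+-comm 1 (suc e)))
         (sumTo-extend (eulerTerm (suc e) (suc p)) (ℕ.m∸n≤m p e) λ l p∸e<l →
            eulerTerm-vanishes (suc e) (suc p) l (s≤s (small l p∸e<l))) ⟩
  rhs (suc e) (suc p) ∎
  where
  N = 2 ℕ.^ (2 ℕ.* suc e ℕ.∸ 1) ℕ.* suc e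
  i = inv (4 ℕ.^ suc p)
  f = fromℕ (4 ℕ.^ e)
  T = sumTo p (eulerTerm (suc e) (suc p))
  N≢0 : NonZero N
  N≢0 = ℕ.m*n≢0 (2 ℕ.^ (2 ℕ.* suc e ℕ.∸ 1)) (suc e) {{ℕ.m^n≢0 2 (2 ℕ.* suc e ℕ.∸ 1)}}
  fromℕ-N : fromℕ N ≡ 2ℚ * f * fromℕ (suc e)
  fromℕ-N = begin
    fromℕ N
      ≡⟨ cong (λ k → fromℕ (2 ℕ.^ (k ℕ.∸ 1) ℕ.* suc e)) (ℕ.*-suc 2 e) ⟩
    fromℕ (2 ℕ.* 2 ℕ.^ (2 ℕ.* e) ℕ.* suc e)
      ≡⟨ cong (λ x → fromℕ (2 ℕ.* x ℕ.* suc e)) (ℕ.^-*-assoc 2 2 e) ⟨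
    fromℕ (2 ℕ.* 4 ℕ.^ e ℕ.* suc e)
      ≡⟨ trans (fromℕ-* (2 ℕ.* 4 ℕ.^ e) (suc e)) (cong (_* fromℕ (suc e)) (fromℕ-* 2 (4 ℕ.^ e))) ⟩
    2ℚ * f * fromℕ (suc e) ∎
  small : ∀ l → p ℕ.∸ e < l → suc p ℕ.∸ l ≤ e
  small l p∸e<l = ℕ.m≤n+o⇒m∸n≤o (suc p) l (subst (suc p ≤_) (ℕ.+-comm e l) (ℕ.≤-<-trans (ℕ.m≤n+m∸n p e) (ℕ.+-monoʳ-< e p∸e<l)))

-- Every n - l is now smaller than d, so the whole Euler part vanishes and only the residue of n
-- z^(2n-1) survives.
lhs-n<d : ∀ e p → suc p ≤ e →
  lhs (suc e) (suc p) ≡ inv (2 ℕ.^ (2 ℕ.* suc e ℕ.∸ 1) ℕ.* suc e) * (fromℕ (suc p) * Φ (suc e) (suc (2 ℕ.* p)))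
lhs-n<d e p p<e = begin
  lhs (suc e) (suc p)
    ≡⟨ lhs≡Φ-⋆-G₀ e (suc p) ⟩
  inv N * (Φ (suc e) ⋆ G₀) (2 ℕ.* suc p)
    ≡⟨ cong (inv N *_) (Φ-⋆-G₀ (suc e) p) ⟩
  inv N * ((Φ (suc e) ⋆ G) (2 ℕ.* suc p) + r)
    ≡⟨ cong (λ x → inv N * (x + r)) (Φ-⋆-G-inv e p) ⟩
  inv N * (inv (4 ℕ.^ suc p) * (2ℚ * fromℕ (suc e) * -4^ e * sumTo p (eulerTerm (suc e) (suc p))) + r)
    ≡⟨ cong (λ t → inv N * (inv (4 ℕ.^ suc p) * (2ℚ * fromℕ (suc e) * -4^ e * t) + r))
         (sumTo-0 p λ l _ → eulerTerm-vanishes (suc e) (suc p) l (s≤s (ℕ.≤-trans (ℕ.m∸n≤m (suc p) l) p<e))) ⟩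
  inv N * (inv (4 ℕ.^ suc p) * (2ℚ * fromℕ (suc e) * -4^ e * 0ℚ) + r)
    ≡⟨ cong (inv N *_) (solve 4 (λ i d s r → i :* (con 2ℚ :* d :* s :* con 0ℚ) :+ r := r) refl
         (inv (4 ℕ.^ suc p)) (fromℕ (suc e)) (-4^ e) r) ⟩
  inv N * r ∎
  where
  N = 2 ℕ.^ (2 ℕ.* suc e ℕ.∸ 1) ℕ.* suc e
  r = fromℕ (suc p) * Φ (suc e) (suc (2 ℕ.* p))

lhs-n<d<2n : ∀ e p → suc p ≤ e → e < suc (2 ℕ.* p) → lhs (suc e) (suc p) ≡ 0ℚ
lhs-n<d<2n e p p<e e<1+2p = begin
  lhs (suc e) (suc p)
    ≡⟨ lhs-n<d e p p<e ⟩
  inv N * (fromℕ (suc p) * fromℕ (φ (suc e) (suc (2 ℕ.* p))))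
    ≡⟨ cong (λ x → inv N * (fromℕ (suc p) * fromℕ x)) (φ-vanishes e (suc (2 ℕ.* p)) e<1+2p) ⟩
  inv N * (fromℕ (suc p) * 0ℚ)
    ≡⟨ solve 2 (λ a b → a :* (b :* con 0ℚ) := con 0ℚ) refl (inv N) (fromℕ (suc p)) ⟩
  0ℚ ∎
  where N = 2 ℕ.^ (2 ℕ.* suc e ℕ.∸ 1) ℕ.* suc e

lhs-2n≤d : ∀ e p → suc p ≤ e → suc (2 ℕ.* p) ≤ e → lhs (suc e) (suc p)
  ≡ fromℕ (suc p) * inv (2 ℕ.^ (2 ℕ.* suc e ℕ.∸ 1) ℕ.* suc e) * fromℕ ((2 ℕ.* suc e ℕ.∸ 2 ℕ.* suc p ℕ.∸ 1) C e)
lhs-2n≤d e p p<e 1+2p≤e = begin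
  lhs (suc e) (suc p)
    ≡⟨ lhs-n<d e p p<e ⟩
  inv N * (fromℕ (suc p) * fromℕ (φ (suc e) (suc (2 ℕ.* p))))
    ≡⟨ cong (λ x → inv N * (fromℕ (suc p) * fromℕ x)) (trans (φ-binomial e (suc (2 ℕ.* p)) 1+2p≤e) (cong (_C e) top)) ⟩
  inv N * (fromℕ (suc p) * fromℕ (m C e))
    ≡⟨ solve 3 (λ a b c → a :* (b :* c) := b :* a :* c) refl (inv N) (fromℕ (suc p)) (fromℕ (m C e)) ⟩
  fromℕ (suc p) * inv N * fromℕ (m C e) ∎
  where
  N = 2 ℕ.^ (2 ℕ.* suc e ℕ.∸ 1) ℕ.* suc e
  m = 2 ℕ.* suc e ℕ.∸ 2 ℕ.* suc p ℕ.∸ 1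
  top : 2 ℕ.* e ℕ.∸ suc (2 ℕ.* p) ≡ m
  top = begin
    2 ℕ.* e ℕ.∸ suc (2 ℕ.* p)                      ≡⟨ cong (2 ℕ.* e ℕ.∸_) (ℕ.+-comm 1 (2 ℕ.* p)) ⟩
    2 ℕ.* e ℕ.∸ (2 ℕ.* p ℕ.+ 1)                    ≡⟨ ℕ.∸-+-assoc (2 ℕ.* e) (2 ℕ.* p) 1 ⟨
    (2 ℕ.+ 2 ℕ.* e) ℕ.∸ (2 ℕ.+ 2 ℕ.* p) ℕ.∸ 1      ≡⟨ cong₂ (λ x y → x ℕ.∸ y ℕ.∸ 1) (ℕ.*-suc 2 e) (ℕ.*-suc 2 p) ⟨
    m                                              ∎

theorem3p1 : (∀ d n → 1 ≤ d → d ≤ n → lhs d n ≡ rhs d n)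
    × (∀ d n → 1 ≤ n → n < d → d < 2 ℕ.* n → lhs d n ≡ 0ℚ)
    × (∀ d n → 1 ≤ n → n < d → 2 ℕ.* n ≤ d
    → lhs d n ≡ fromℕ n * inv (2 ℕ.^ (2 ℕ.* d ℕ.∸ 1) ℕ.* d) * fromℕ ((2 ℕ.* d ℕ.∸ 2 ℕ.* n ℕ.∸ 1) C (d ℕ.∸ 1)))
theorem3p1 =
    (λ { (suc e) (suc p) _ (s≤s e≤p) → lhs≡rhs e p e≤p })
  , (λ { (suc e) (suc p) _ (s≤s p<e) d<2n →
         lhs-n<d<2n e p p<e (ℕ.s≤s⁻¹ (subst (suc e <_) (ℕ.*-suc 2 p) d<2n)) })
  , (λ { (suc e) (suc p) _ (s≤s p<e) 2n≤d →
         lhs-2n≤d e p p<e (ℕ.s≤s⁻¹ (subst (_≤ suc e) (ℕ.*-suc 2 p) 2n≤d)) })
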